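{- Let $k\ge 7$ be an integer and let $G$ be a $K_5$-minor-free, non-complete, 3-connected graph. If $d(S_k)\ge 3$, then $G$ is $f$-list colorable, where $f(v)=\min\{d(v),k\}$ for all $v\in V(G)$.
   Context: For a graph $G$, $d(v)$ denotes the degree of $v$. For an integer $k$, $S_k=\{v\in V(G): d(v)<k\}$, and $d(S_k)$ denotes the smallest distance in $G$ between two distinct connected components of the induced subgraph $G[S_k]$; if $G[S_k]$ has at most one component, $d(S_k)=0$. A list assignment $L$ assigns a set $L(v)$ of colors to each vertex; $G$ is $L$-colorable if there is a proper coloring $\varphi$ with $\varphi(v)\in L(v)$ for all $v$. For $f:V(G)\to\mathbb{N}$, $G$ is $f$-list colorable if it is $L$-colorable for every list assignment $L$ with $|L(v)|=f(v)$ for all $v$. A graph is $K_5$-minor-free if it has no minor isomorphic to $K_5$. -}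

module Defs where

open import Data.Nat using (ℕ; zero; suc; _<_; _≤_; _⊓_)
open import Data.Fin using (Fin)
open import Data.Bool using (Bool; true; false)
open import Data.List using (List; length; filterᵇ; allFin)
open import Data.List.Membership.Propositional using (_∈_; _∉_)
open import Data.List.Relation.Unary.Unique.Propositional using (Unique)
open import Data.Product using (Σ; ∃; ∃-syntax; _×_)
open import Relation.Binary.PropositionalEquality using (_≡_; _≢_)
open import Relation.Nullary using (¬_; yes; no)
open import Relation.Nullary.Decidable using (isYes)
open import Data.Fin using (_≟_)
open import Data.Bool using (not)
open import Data.Unit using (⊤)
open import Data.Empty using (⊥-elim)
open import Relation.Binary.PropositionalEquality using (refl; sym)

record Graph : Set where
  field
    n     : ℕ
    adj   : Fin n → Fin n → Bool
    adj-sym : ∀ u v → adj u v ≡ adj v u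
    adj-irrefl : ∀ v → adj v v ≡ false

open Graph public

Vertex : Graph → Set
Vertex G = Fin (n G)

Adj : (G : Graph) → Vertex G → Vertex G → Set
Adj G u v = adj G u v ≡ true

deg : (G : Graph) → Vertex G → ℕ
deg G v = length (filterᵇ (adj G v) (allFin (n G)))

data WalkIn (G : Graph) (P : Vertex G → Set) : Vertex G → Vertex G → ℕ → Set where
  here : ∀ {u} → P u → WalkIn G P u u zero
  step : ∀ {u w v ℓ} → P u → Adj G u w → WalkIn G P w v ℓ → WalkIn G P u v (suc ℓ)

ConnectedIn : (G : Graph) → (Vertex G → Set) → Vertex G → Vertex G → Set
ConnectedIn G P u v = ∃[ ℓ ] WalkIn G P u v ℓ

ConnectedSet : (G : Graph) → (Vertex G → Set) → Set
ConnectedSet G P = ∀ u v → P u → P v → ConnectedIn G P u v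

NonComplete : Graph → Set
NonComplete G = ∃[ u ] ∃[ v ] (u ≢ v × ¬ Adj G u v)

-- k-connected (Diestel): |G| > k and G - X is connected for every X with |X| < k
KConnected : ℕ → Graph → Set
KConnected k G = (k < n G) × (∀ (X : List (Vertex G)) → length X < k →
  ConnectedSet G (λ x → x ∉ X))

HasMinor : Graph → Graph → Set
HasMinor G H = Σ (Vertex H → Vertex G → Bool) λ B →
    (∀ h → ∃[ v ] B h v ≡ true)
  × (∀ h → ConnectedSet G (λ v → B h v ≡ true))
  × (∀ h h' v → h ≢ h' → B h v ≡ true → B h' v ≡ false)
  × (∀ h h' → Adj H h h' → ∃[ u ] ∃[ v ] (B h u ≡ true × B h' v ≡ true × Adj G u v))

Kadj : ∀ {m} → Fin m → Fin m → Bool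
Kadj u v = not (isYes (u ≟ v))

Kadj-sym : ∀ {m} (u v : Fin m) → Kadj u v ≡ Kadj v u
Kadj-sym u v with u ≟ v | v ≟ u
... | yes _ | yes _ = refl
... | no _ | no _ = refl
... | yes p | no q = ⊥-elim (q (sym p))
... | no p | yes q = ⊥-elim (p (sym q))

Kadj-irrefl : ∀ {m} (v : Fin m) → Kadj v v ≡ false
Kadj-irrefl v with v ≟ v
... | yes _ = refl
... | no p = ⊥-elim (p refl)

K : ℕ → Graph
K m = record { n = m ; adj = Kadj ; adj-sym = Kadj-sym ; adj-irrefl = Kadj-irrefl }

InS : (G : Graph) → ℕ → Vertex G → Set
InS G k v = deg G v < k

DistGe3 : (G : Graph) → Vertex G → Vertex G → Set
DistGe3 G u v = ∀ ℓ → ℓ < 3 → ¬ WalkIn G (λ _ → ⊤) u v ℓ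

-- d(S_k) ≥ 3, with the convention d(S_k) = 0 if G[S_k] has at most one component:
-- G[S_k] has at least two components, and any two vertices of S_k lying in
-- distinct components of G[S_k] are at distance at least 3 in G.
DSGe3 : (G : Graph) → ℕ → Set
DSGe3 G k =
    (∃[ u ] ∃[ v ] (InS G k u × InS G k v × ¬ ConnectedIn G (InS G k) u v))
  × (∀ u v → InS G k u → InS G k v → ¬ ConnectedIn G (InS G k) u v → DistGe3 G u v)

-- list assignment with colours from ℕ; L(v) is a set (duplicate-free list)
ListAssignment : Graph → Set
ListAssignment G = Vertex G → List ℕ

LColorable : (G : Graph) → ListAssignment G → Set
LColorable G L = Σ (Vertex G → ℕ) λ φ →
  (∀ v → φ v ∈ L v) × (∀ u v → Adj G u v → φ u ≢ φ v)

FListColorable : (G : Graph) → (Vertex G → ℕ) → Set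
FListColorable G f = ∀ (L : ListAssignment G) →
  (∀ v → Unique (L v)) → (∀ v → length (L v) ≡ f v) → LColorable G L

{-# OPTIONS --safe #-}
-- K₅-minor-free graphs are 5-choosable, by Thomassen's induction carried out with contractions instead of a plane
-- drawing: a root z stands for the outer face, its neighbours are the boundary (lists of size 3, others 5), and
-- deleting a boundary vertex is contracting it into z.  If no boundary vertex can be deleted, then either there is
-- a K₅ minor containing z, or two vertices separate the graph; contracting each side makes them an edge of the other.
--
-- Every component C of G[S_k] is contracted to a neighbour x of C, and up to two colours are forbidden around C; since
-- components are at distance at least 3, vertices of degree at least k ≥ 7 keep 5 colours and can be coloured.  The
-- choice is made such that any such colouring extends to C: two colours of L(u) are forbidden if u has at most one
-- neighbour in C; a colour of L(u) ∖ L(v) if u, v are adjacent and C − u is connected; and x is a neighbour of u but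
-- not of v if both C − u and C − v are connected.  If none of this is possible, then an end part T of C consists of
-- vertices with the same neighbours outside C, and 3-connectivity gives a K₅ minor.
--
-- Case distinctions are made under double negation, which is removed at the end because colourability is decidable.
module Submission where

open import Defs
open import Function using (_∘_; id)
open import Data.Bool using (Bool; true; false)
import Data.Bool as Bool
open import Data.Nat using (ℕ; zero; suc; _≤_; _<_; _⊓_; z≤n; s≤s; _+_)
import Data.Nat as ℕ
import Data.Nat.Properties as ℕ
open import Data.Fin using (Fin; zero; suc; _≟_)
open import Data.Fin.Properties using (all?)
open import Data.List using (List; []; _∷_; length; filter; filterᵇ; map; allFin)
open import Data.List.Properties using (length-map; filter-notAll; filter-≐)
open import Data.List.Membership.Propositional using (_∈_; _∉_; lose; find)
open import Data.List.Membership.Propositional.Properties using (∈-filter⁺; ∈-filter⁻; ∈-allFin; ∈-map⁺)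
open import Data.List.Relation.Unary.Any using (Any; here; there; any?)
open import Data.List.Relation.Unary.All using (All; []; _∷_)
open import Data.List.Relation.Unary.AllPairs using ([]; _∷_)
open import Data.List.Relation.Unary.Unique.Propositional using (Unique)
import Data.List.Relation.Unary.Unique.Propositional.Properties as Unique
open import Data.Product using (Σ; ∃-syntax; _×_; _,_; proj₁; proj₂)
open import Data.Sum using (_⊎_; inj₁; inj₂; [_,_]′)
open import Data.Unit using (⊤; tt)
open import Data.Empty using (⊥; ⊥-elim)
open import Relation.Binary.Definitions using (DecidableEquality)
open import Relation.Binary.PropositionalEquality using (_≡_; _≢_; refl; sym; trans; cong; subst; ≢-sym)
open import Relation.Nullary using (¬_; Dec; yes; no; does; ¬?)
open import Relation.Nullary.Decidable using (map′; dec-true; dec-false; _×-dec_; _→-dec_; decidable-stable)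

private variable
  N : ℕ

-- Double negation and duplicate-free lists.

em : {P : Set} → ¬ ¬ Dec P
em k = k (no (k ∘ yes))

by-cases : (P : Set) → (P → ⊥) → (¬ P → ⊥) → ⊥
by-cases P f g = g f

-- The index set is finite, so the double negations are pulled out one index at a time.
¬¬-Π : {P : Fin N → Set} → (∀ i → ¬ ¬ P i) → ¬ ¬ (∀ i → P i)
¬¬-Π {zero}  h k = k λ ()
¬¬-Π {suc N} h k = h zero λ p₀ → ¬¬-Π (h ∘ suc) λ ps → k λ { zero → p₀ ; (suc i) → ps i }

decide : {P : Fin N → Set} → ¬ ¬ (∀ x → Dec (P x))
decide = ¬¬-Π λ _ → em

decide₂ : ∀ {m} {P : Fin m → Fin N → Set} → ¬ ¬ (∀ x y → Dec (P x y))
decide₂ = ¬¬-Π λ _ → decide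

≤0-nil : ∀ {A : Set} {xs : List A} → length xs ≤ 0 → ∀ {x} → x ∉ xs
≤0-nil {xs = []} _ ()

∈-singleton : ∀ {A : Set} {x c : A} {xs} → xs ≡ c ∷ [] → x ∈ xs → x ≡ c
∈-singleton refl (here e) = e

module _ {A : Set} (_≟A_ : DecidableEquality A) where

  remove : A → List A → List A
  remove c = filter (λ x → ¬? (x ≟A c))

  length-remove : ∀ c {xs} → Unique xs → length xs ≤ suc (length (remove c xs))
  length-remove c [] = z≤n
  length-remove c {x ∷ xs} (x∉ ∷ u) with x ≟A c
  ... | no _ = s≤s (length-remove c u)
  ... | yes refl = s≤s (ℕ.≤-reflexive (cong length (sym (keep-all x∉))))
    where
    keep-all : ∀ {ys} → All (c ≢_) ys → remove c ys ≡ ys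
    keep-all [] = refl
    keep-all {y ∷ ys} (c≢y ∷ h) with y ≟A c
    ... | yes y≡c = ⊥-elim (c≢y (sym y≡c))
    ... | no _ = cong (y ∷_) (keep-all h)

  remove-shrinks : ∀ {c xs} → c ∈ xs → length (remove c xs) < length xs
  remove-shrinks c∈ = filter-notAll _ _ (lose c∈ (λ c≢c → c≢c refl))

  -- As `xs` has no duplicates, discarding one element of `ys` costs `xs` at most one element.
  ∃-∉ : ∀ {xs} → Unique xs → ∀ ys → length ys < length xs → ∃[ c ] (c ∈ xs × c ∉ ys)
  ∃-∉ {x ∷ _} u [] _ = x , here refl , λ ()
  ∃-∉ u (y ∷ ys) l with ∃-∉ (Unique.filter⁺ (λ x → ¬? (x ≟A y)) u) ys
                          (ℕ.≤-pred (ℕ.≤-trans l (length-remove y u)))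
  ... | c , c∈ , c∉ with ∈-filter⁻ (λ x → ¬? (x ≟A y)) c∈
  ... | c∈xs , c≢y = c , c∈xs , λ { (here c≡y) → c≢y c≡y ; (there c∈ys) → c∉ c∈ys }

  ⊆-length : ∀ {xs ys} → Unique xs → (∀ {x} → x ∈ xs → x ∈ ys) → length xs ≤ length ys
  ⊆-length u sub = ℕ.≮⇒≥ λ l → let _ , c∈ , c∉ = ∃-∉ u _ l in c∉ (sub c∈)

-- Paths and connected sets.

data Path (A : Fin N → Fin N → Set) (P : Fin N → Set) : Fin N → Fin N → Set where
  stop : ∀ {x} → P x → Path A P x x
  go   : ∀ {x y z} → P x → A x y → Path A P y z → Path A P x z

Symm Irr : (Fin N → Fin N → Set) → Set
Symm A = ∀ {x y} → A x y → A y x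
Irr A = ∀ {x} → ¬ A x x

Conn : (Fin N → Fin N → Set) → (Fin N → Set) → Set
Conn A P = ∀ {x y} → P x → P y → Path A P x y

Disj : (Fin N → Set) → (Fin N → Set) → Set
Disj P Q = ∀ {x} → P x → Q x → ⊥

Touch : (Fin N → Fin N → Set) → (Fin N → Set) → (Fin N → Set) → Set
Touch A P Q = ∃[ x ] ∃[ y ] (P x × Q y × A x y)

module _ {A : Fin N → Fin N → Set} where

  source : ∀ {P x y} → Path A P x y → P x
  source (stop p) = p
  source (go p _ _) = p

  target : ∀ {P x y} → Path A P x y → P y
  target (stop p) = p
  target (go _ _ w) = target w

  mapP : ∀ {P Q x y} → (∀ {w} → P w → Q w) → Path A P x y → Path A Q x y
  mapP f (stop p) = stop (f p)
  mapP f (go p a w) = go (f p) a (mapP f w)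

  _++P_ : ∀ {P x y z} → Path A P x y → Path A P y z → Path A P x z
  stop _ ++P v = v
  go p a w ++P v = go p a (w ++P v)

  snoc : ∀ {P x y z} → Path A P x y → A y z → P z → Path A P x z
  snoc w a p = w ++P go (target w) a (stop p)

  reverse : Symm A → ∀ {P x y} → Path A P x y → Path A P y x
  reverse s (stop p) = stop p
  reverse s (go p a w) = snoc (reverse s w) (s a) p

  -- The first entry into `K` is taken, so that the part before it can serve in a branch set
  -- disjoint from `K`.
  cross : ∀ {P} {K : Fin N → Set} → (∀ x → Dec (K x)) → ∀ {x y} → Path A P x y → ¬ K x → K y →
    ∃[ a ] ∃[ b ] (Path A (λ w → P w × ¬ K w) x a × P b × K b × A a b)
  cross K? (stop _) ¬Kx Ky = ⊥-elim (¬Kx Ky)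
  cross K? (go {x} {w} p a π) ¬Kx Ky with K? w
  ... | yes Kw = x , w , stop (p , ¬Kx) , source π , Kw , a
  ... | no ¬Kw with cross K? π ¬Kw Ky
  ... | c , b , ρ , q = c , b , go (p , ¬Kx) a ρ , q

  reach : ∀ {P x y} → Path A P x y → Path A (Path A P x) x y
  reach = go-on stop
    where
    go-on : ∀ {P x u y} → (P u → Path A P x u) → Path A P u y → Path A (Path A P x) u y
    go-on h (stop p) = stop (h p)
    go-on h (go p a w) = go (h p) a (go-on (λ q → snoc (h p) a q) w)

  comp-conn : Symm A → ∀ {P x} → Conn A (Path A P x)
  comp-conn s w v = reverse s (reach w) ++P reach v

  single-conn : ∀ x → Conn A (_≡ x)
  single-conn x refl refl = stop refl

-- Models of K₅ by branch sets.

record K5 (A : Fin N → Fin N → Set) : Set₁ where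
  field
    B     : Fin 5 → Fin N → Set
    conn  : ∀ i → Conn A (B i)
    disj  : ∀ i j → i ≢ j → Disj (B i) (B j)
    touch : ∀ i j → i ≢ j → Touch A (B i) (B j)

K5Free : (Fin N → Fin N → Set) → Set₁
K5Free A = ¬ K5 A

module _ {A : Fin N → Fin N → Set} (symA : Symm A) where

  private
    pattern 0F = zero
    pattern 1F = suc zero
    pattern 2F = suc (suc zero)
    pattern 3F = suc (suc (suc zero))
    pattern 4F = suc (suc (suc (suc zero)))

  Sep : (Fin N → Set) → (Fin N → Set) → Set
  Sep P Q = Disj P Q × Touch A P Q

  Sep-sym : ∀ {P Q} → Sep P Q → Sep Q P
  Sep-sym (d , x , y , px , qy , a) = (λ q p → d p q) , y , x , qy , px , symA a

  mkK5 : ∀ P Q R S T → Conn A P → Conn A Q → Conn A R → Conn A S → Conn A T →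
    Sep P Q → Sep P R → Sep P S → Sep P T → Sep Q R → Sep Q S → Sep Q T →
    Sep R S → Sep R T → Sep S T → K5 A
  mkK5 P Q R S T cP cQ cR cS cT PQ PR PS PT QR QS QT RS RT ST = record
    { B = B ; conn = λ { 0F → cP ; 1F → cQ ; 2F → cR ; 3F → cS ; 4F → cT }
    ; disj = λ i j ne → proj₁ (sep i j ne) ; touch = λ i j ne → proj₂ (sep i j ne) }
    where
    B : Fin 5 → Fin N → Set
    B 0F = P
    B 1F = Q
    B 2F = R
    B 3F = S
    B 4F = T
    sep : ∀ i j → i ≢ j → Sep (B i) (B j)
    sep 0F 0F ne = ⊥-elim (ne refl)
    sep 0F 1F ne = PQ
    sep 0F 2F ne = PR
    sep 0F 3F ne = PS
    sep 0F 4F ne = PT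
    sep 1F 0F ne = Sep-sym PQ
    sep 1F 1F ne = ⊥-elim (ne refl)
    sep 1F 2F ne = QR
    sep 1F 3F ne = QS
    sep 1F 4F ne = QT
    sep 2F 0F ne = Sep-sym PR
    sep 2F 1F ne = Sep-sym QR
    sep 2F 2F ne = ⊥-elim (ne refl)
    sep 2F 3F ne = RS
    sep 2F 4F ne = RT
    sep 3F 0F ne = Sep-sym PS
    sep 3F 1F ne = Sep-sym QS
    sep 3F 2F ne = Sep-sym RS
    sep 3F 3F ne = ⊥-elim (ne refl)
    sep 3F 4F ne = ST
    sep 4F 0F ne = Sep-sym PT
    sep 4F 1F ne = Sep-sym QT
    sep 4F 2F ne = Sep-sym RT
    sep 4F 3F ne = Sep-sym ST
    sep 4F 4F ne = ⊥-elim (ne refl)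

-- Contractions.

-- F x₀ x says that x₀ belongs to the branch set contracted to x; vertices related to nothing are deleted.
Quot : (Fin N → Fin N → Set) → (Fin N → Fin N → Set) → Fin N → Fin N → Set
Quot A F x y = x ≢ y × ∃[ x₀ ] ∃[ y₀ ] (F x₀ x × F y₀ y × A x₀ y₀)

module _ {A F : Fin N → Fin N → Set} where

  Quot-sym : Symm A → Symm (Quot A F)
  Quot-sym s (ne , x₀ , y₀ , f , g , a) = ≢-sym ne , y₀ , x₀ , g , f , s a

  Quot-irr : Irr (Quot A F)
  Quot-irr (ne , _) = ne refl

  -- Branch sets are pulled back along `F`: connected fibres keep them connected, and
  -- single-valuedness keeps them disjoint.
  Quot-free : (∀ {x₀ x y} → F x₀ x → F x₀ y → x ≡ y) → (∀ x → Conn A (λ w → F w x)) →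
    K5Free A → K5Free (Quot A F)
  Quot-free fun fib free k = free record
    { B = B′ ; conn = λ i → λ { (x , bx , fx) (y , by , fy) → lift i (K5.conn k i bx by) fx fy }
    ; disj = λ { i j ne (x , bx , fx) (y , by , fy) →
                 K5.disj k i j ne bx (subst (K5.B k j) (fun fy fx) by) }
    ; touch = λ i j ne → let x , y , bx , by , _ , x₀ , y₀ , fx , fy , a = K5.touch k i j ne in
                x₀ , y₀ , (x , bx , fx) , (y , by , fy) , a }
    where
    B′ : Fin 5 → Fin _ → Set
    B′ i x₀ = ∃[ x ] (K5.B k i x × F x₀ x)
    lift : ∀ i {x y} → Path (Quot A F) (K5.B k i) x y → ∀ {x₀ y₀} → F x₀ x → F y₀ y → Path A (B′ i) x₀ y₀
    lift i (stop {x} bx) fx fy = mapP (λ f → x , bx , f) (fib _ fx fy)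
    lift i (go {x} bx (_ , x₁ , w₀ , fx₁ , fw , a) π) fx fy =
      mapP (λ f → x , bx , f) (fib _ fx fx₁) ++P go (x , bx , fx₁) a (lift i π fw fy)

Merge : (Fin N → Set) → Fin N → Fin N → Fin N → Set
Merge Q r x₀ x = (Q x₀ × x ≡ r) ⊎ (¬ Q x₀ × x ≡ x₀)

module _ {A : Fin N → Fin N → Set} {Q : Fin N → Set} {r : Fin N} (Qr : Q r) where

  Merge-free : Conn A Q → K5Free A → K5Free (Quot A (Merge Q r))
  Merge-free cQ = Quot-free fun fib
    where
    fun : ∀ {x₀ x y} → Merge Q r x₀ x → Merge Q r x₀ y → x ≡ y
    fun (inj₁ (_ , refl)) (inj₁ (_ , refl)) = refl
    fun (inj₁ (q , _)) (inj₂ (nq , _)) = ⊥-elim (nq q)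
    fun (inj₂ (nq , _)) (inj₁ (q , _)) = ⊥-elim (nq q)
    fun (inj₂ (_ , refl)) (inj₂ (_ , refl)) = refl
    fib : ∀ x → Conn A (λ w → Merge Q r w x)
    fib x (inj₁ (q , refl)) (inj₁ (q′ , refl)) = mapP (λ q → inj₁ (q , refl)) (cQ q q′)
    fib x (inj₁ (q , refl)) (inj₂ (nq , refl)) = ⊥-elim (nq Qr)
    fib x (inj₂ (nq , refl)) (inj₁ (q , refl)) = ⊥-elim (nq Qr)
    fib x (inj₂ (nq , refl)) (inj₂ (_ , refl)) = stop (inj₂ (nq , refl))

  -- The hypotheses express that `x` and `y` survive: a vertex of `Q` other than `r` is contracted
  -- away.
  Merge-keeps : ∀ {x y} → (Q x → x ≡ r) → (Q y → y ≡ r) → x ≢ y → A x y → Quot A (Merge Q r) x y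
  Merge-keeps {x} {y} hx hy ne a = ne , x , y , self hx , self hy , a
    where
    self : ∀ {w} → (Q w → w ≡ r) → Merge Q r w w
    self {w} h with w ≟ r
    ... | yes refl = inj₁ (Qr , refl)
    ... | no w≢r = inj₂ (w≢r ∘ h , refl)

  Merge-root : ∀ {x q} → ¬ Q x → Q q → A x q → Quot A (Merge Q r) x r
  Merge-root {x} {q} nx Qq a = (λ { refl → nx Qr }) , x , q , inj₂ (nx , refl) , inj₁ (Qq , refl) , a

-- Simple paths and rooted models of K₅.

data SPath (A : Fin N → Fin N → Set) : Fin N → Fin N → List (Fin N) → Set where
  end  : ∀ {a} → SPath A a a (a ∷ [])
  step : ∀ {a b c vs} → A a b → a ∉ vs → SPath A b c vs → SPath A a c (a ∷ vs)

module _ {A : Fin N → Fin N → Set} where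

  open import Data.List.Membership.DecPropositional (_≟_ {N}) using (_∈?_)

  first∈ : ∀ {a b vs} → SPath A a b vs → a ∈ vs
  first∈ end = here refl
  first∈ (step _ _ _) = here refl

  last∈ : ∀ {a b vs} → SPath A a b vs → b ∈ vs
  last∈ end = here refl
  last∈ (step _ _ s) = there (last∈ s)

  suffix : ∀ {a b c vs} → SPath A b c vs → a ∈ vs → ∃[ us ] (SPath A a c us × (∀ {w} → w ∈ us → w ∈ vs))
  suffix end (here refl) = _ , end , id
  suffix s@(step _ _ _) (here refl) = _ , s , id
  suffix (step _ _ s) (there a∈) with suffix s a∈
  ... | us , t , sub = us , t , there ∘ sub

  simple : ∀ {P x y} → Path A P x y → ∃[ vs ] (SPath A x y vs × (∀ {w} → w ∈ vs → P w))
  simple (stop p) = _ , end , λ { (here refl) → p }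
  simple (go {x} p a w) with simple w
  ... | vs , s , h with x ∈? vs
  ... | no x∉ = _ , step a x∉ s , λ { (here refl) → p ; (there w∈) → h w∈ }
  ... | yes x∈ = let us , t , sub = suffix s x∈ in us , t , h ∘ sub

  cons-conn : Symm A → ∀ {a b vs} → A a b → b ∈ vs → Conn A (_∈ vs) → Conn A (_∈ (a ∷ vs))
  cons-conn sA a b∈ cv (here refl) (here refl) = stop (here refl)
  cons-conn sA a b∈ cv (here refl) (there y∈) = go (here refl) a (mapP there (cv b∈ y∈))
  cons-conn sA a b∈ cv (there x∈) (here refl) = snoc (mapP there (cv x∈ b∈)) (sA a) (here refl)
  cons-conn sA a b∈ cv (there x∈) (there y∈) = mapP there (cv x∈ y∈)

  spath-conn : Symm A → ∀ {a b vs} → SPath A a b vs → Conn A (_∈ vs)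
  spath-conn sA end (here refl) (here refl) = stop (here refl)
  spath-conn sA (step a _ s) = cons-conn sA a (first∈ s) (spath-conn sA s)

  record Split (a b : Fin N) (vs : List (Fin N)) (T : Fin N → Set) : Set where
    field
      xs ys : List (Fin N)
      xs⊆ : ∀ {w} → w ∈ xs → w ∈ vs
      ys⊆ : ∀ {w} → w ∈ ys → w ∈ vs
      xs-conn : Conn A (_∈ xs)
      ys-conn : Conn A (_∈ ys)
      disj : Disj (_∈ xs) (_∈ ys)
      touch : Touch A (_∈ xs) (_∈ ys)
      a∈xs : a ∈ xs
      b∈ys : b ∈ ys
      xs-T : ∃[ x ] (x ∈ xs × T x)
      ys-T : ∃[ y ] (y ∈ ys × T y)

  -- The path is cut right after its first vertex in `T`. A later vertex in `T` then lies in the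
  -- second piece; if there is none, the first one is the only one, and if `T` misses the path, any
  -- `r` will do.
  split : Symm A → ∀ {a b vs T} → (∀ x → Dec (T x)) → SPath A a b vs →
    Split a b vs T ⊎ (∃[ r ] (r ∈ vs × ∀ {x} → x ∈ vs → T x → x ≡ r))
  split sA T? (end {a}) = inj₂ (a , here refl , λ { (here refl) _ → refl })
  split sA {T = T} T? (step {a} {b} {vs = vs} ab a∉ s) with T? a | any? T? vs
  ... | yes Ta | yes Tvs = inj₁ record
    { xs = a ∷ [] ; ys = vs ; xs⊆ = λ { (here refl) → here refl } ; ys⊆ = there
    ; xs-conn = λ { (here refl) (here refl) → stop (here refl) } ; ys-conn = spath-conn sA s
    ; disj = λ { (here refl) → a∉ } ; touch = a , b , here refl , first∈ s , ab
    ; a∈xs = here refl ; b∈ys = last∈ s ; xs-T = a , here refl , Ta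
    ; ys-T = find Tvs }
  ... | yes Ta | no ¬Tvs = inj₂ (a , here refl , λ
    { (here refl) _ → refl ; (there x∈) Tx → ⊥-elim (¬Tvs (lose x∈ Tx)) })
  ... | no ¬Ta | _ with split sA T? s
  ... | inj₂ (r , r∈ , h) = inj₂ (r , there r∈ , λ
    { (here refl) Tx → ⊥-elim (¬Ta Tx) ; (there x∈) → h x∈ })
  ... | inj₁ σ = inj₁ record
    { xs = a ∷ xs ; ys = ys ; xs⊆ = λ { (here refl) → here refl ; (there w) → there (xs⊆ w) }
    ; ys⊆ = there ∘ ys⊆ ; xs-conn = cons-conn sA ab a∈xs xs-conn ; ys-conn = ys-conn
    ; disj = λ { (here refl) y∈ → a∉ (ys⊆ y∈) ; (there x∈) → disj x∈ }
    ; touch = let x , y , x∈ , r = touch in x , y , there x∈ , r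
    ; a∈xs = here refl ; b∈ys = b∈ys
    ; xs-T = let x , x∈ , t = xs-T in x , there x∈ , t ; ys-T = ys-T }
    where open Split σ

-- A K₃ minor rooted at common neighbours of the adjacent vertices z and v.
rooted-K5 : {A : Fin N → Fin N → Set} → Symm A → ∀ {z v a b c vs} {Z : Fin N → Set} →
  z ≢ v → A z v → Conn A Z → Disj Z (_∈ vs) → ¬ Z z → ¬ Z v → z ∉ vs → v ∉ vs →
  Z a → A z a → A v a → A z b → A v b → A z c → A v c →
  Split {A = A} b c vs (λ y → ∃[ x ] (Z x × A x y)) → K5 A
rooted-K5 {A = A} sA {z} {v} {a} {b} {c} {vs} {Z} z≢v zv cZ dZ ¬Zz ¬Zv z∉ v∉ Za za va zb vb zc vc σ =
  mkK5 sA (_≡ z) (_≡ v) Z (_∈ xs) (_∈ ys)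
    (single-conn z) (single-conn v) cZ xs-conn ys-conn
    ((λ { refl e → z≢v e }) , z , v , refl , refl , zv)
    ((λ { refl → ¬Zz }) , z , a , refl , Za , za)
    ((λ { refl x∈ → z∉ (xs⊆ x∈) }) , z , b , refl , a∈xs , zb)
    ((λ { refl x∈ → z∉ (ys⊆ x∈) }) , z , c , refl , b∈ys , zc)
    ((λ { refl → ¬Zv }) , v , a , refl , Za , va)
    ((λ { refl x∈ → v∉ (xs⊆ x∈) }) , v , b , refl , a∈xs , vb)
    ((λ { refl x∈ → v∉ (ys⊆ x∈) }) , v , c , refl , b∈ys , vc)
    ((λ zx x∈ → dZ zx (xs⊆ x∈)) , (let y , y∈ , x , Zx , xy = xs-T in x , y , Zx , y∈ , xy))
    ((λ zx x∈ → dZ zx (ys⊆ x∈)) , (let y , y∈ , x , Zx , xy = ys-T in x , y , Zx , y∈ , xy))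
    (disj , touch)
  where open Split σ

-- Colour lists.

remV : Fin N → List (Fin N) → List (Fin N)
remV = remove _≟_

remC : ℕ → List ℕ → List ℕ
remC = remove ℕ._≟_

∈-remove⁺ : ∀ {A : Set} (_≟A_ : DecidableEquality A) {x v l} → x ∈ l → x ≢ v → x ∈ remove _≟A_ v l
∈-remove⁺ _≟A_ = ∈-filter⁺ (λ y → ¬? (y ≟A _))

∈-remove⁻ : ∀ {A : Set} (_≟A_ : DecidableEquality A) {x} v l → x ∈ remove _≟A_ v l → x ∈ l × x ≢ v
∈-remove⁻ _≟A_ v l = ∈-filter⁻ (λ y → ¬? (y ≟A v)) {xs = l}

remC-unique : ∀ c {xs} → Unique xs → Unique (remC c xs)
remC-unique c = Unique.filter⁺ (λ x → ¬? (x ℕ.≟ c))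

assign : (Fin N → List ℕ) → Fin N → ℕ → Fin N → List ℕ
assign L p c x with x ≟ p
... | yes _ = c ∷ []
... | no _ = L x

module _ {L : Fin N → List ℕ} {p : Fin N} {c : ℕ} where

  assign-≡ : assign L p c p ≡ c ∷ []
  assign-≡ with p ≟ p
  ... | yes _ = refl
  ... | no ne = ⊥-elim (ne refl)

  assign-≢ : ∀ {x} → x ≢ p → assign L p c x ≡ L x
  assign-≢ {x} ne with x ≟ p
  ... | yes e = ⊥-elim (ne e)
  ... | no _ = refl

  assign-unique : (∀ x → Unique (L x)) → ∀ x → Unique (assign L p c x)
  assign-unique u x with x ≟ p
  ... | yes _ = [] ∷ []
  ... | no _ = u x

  assign-⊆ : c ∈ L p → ∀ {x d} → d ∈ assign L p c x → d ∈ L x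
  assign-⊆ c∈ {x} d∈ with x ≟ p
  assign-⊆ c∈ (here refl) | yes refl = c∈
  ... | no _ = d∈

-- Taking `s` equal to `t` withholds a single colour, so one definition serves both uses.
prune : {P : Set} → Dec P → ℕ → ℕ → List ℕ → List ℕ
prune (yes _) s t xs = remC s (remC t xs)
prune (no _) s t xs = xs

prune-unique : ∀ {P : Set} (d : Dec P) s t {xs} → Unique xs → Unique (prune d s t xs)
prune-unique (yes _) s t u = remC-unique s (remC-unique t u)
prune-unique (no _) s t u = u

prune-⊆ : ∀ {P : Set} (d : Dec P) s t {xs c} → c ∈ prune d s t xs → c ∈ xs
prune-⊆ (yes _) s t {xs} c∈ = proj₁ (∈-remove⁻ ℕ._≟_ t xs (proj₁ (∈-remove⁻ ℕ._≟_ s _ c∈)))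
prune-⊆ (no _) s t c∈ = c∈

prune-avoid : ∀ {P : Set} (d : Dec P) s t {xs c} → P → c ∈ prune d s t xs → c ≢ s × c ≢ t
prune-avoid (yes _) s t {xs} _ c∈ =
  let c∈′ , c≢s = ∈-remove⁻ ℕ._≟_ s (remC t xs) c∈ in c≢s , proj₂ (∈-remove⁻ ℕ._≟_ t xs c∈′)
prune-avoid (no ¬p) s t p c∈ = ⊥-elim (¬p p)

prune-length : ∀ {P : Set} (d : Dec P) s t {xs} → Unique xs → length xs ≤ 2 + length (prune d s t xs)
prune-length (yes _) s t u =
  ℕ.≤-trans (length-remove ℕ._≟_ t u) (s≤s (length-remove ℕ._≟_ s (remC-unique t u)))
prune-length (no _) s t u = ℕ.m≤n⇒m≤o+n 2 ℕ.≤-refl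

-- Five-choosability: rooted instances and deletion of a boundary vertex.

-- The vertices of l are to be coloured; z plays the part of the outer face, whose boundary is the set of its neighbours.
record Rooted (N : ℕ) : Set₁ where
  field
    A    : Fin N → Fin N → Set
    symA : Symm A
    irrA : Irr A
    free : K5Free A
    z    : Fin N
    l    : List (Fin N)
    z∉l  : z ∉ l
    L    : Fin N → List ℕ
    uniq : ∀ x → Unique (L x)

  Col : Set
  Col = Σ (Fin N → ℕ) λ φ →
    (∀ {x} → x ∈ l → φ x ∈ L x) × (∀ {x y} → x ∈ l → y ∈ l → A x y → φ x ≢ φ y)

  -- `Pre` is meant for the precoloured vertices, whose lists are singletons.
  Sizes : (Fin N → Set) → Set
  Sizes Pre = ∀ {x} → x ∈ l → ¬ Pre x → 3 ≤ length (L x) × (¬ A z x → 5 ≤ length (L x))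

  ≢z : ∀ {x} → x ∈ l → x ≢ z
  ≢z x∈ refl = z∉l x∈

module FiveChoosability {N : ℕ} where

  open Rooted

  -- Contract the edge zv and colour v last, with one of two colours withheld from the neighbours of v off the boundary.
  module Absorb (S : Rooted N) (v : Fin N) (v∈l : v ∈ l S) (zv : A S (z S) v) (s₁ s₂ : ℕ)
    (D : ∀ x → Dec (¬ A S (z S) x × A S v x)) where

    private
      Q : Fin N → Set
      Q x = x ≡ z S ⊎ x ≡ v
      cQ : Conn (A S) Q
      cQ (inj₁ refl) (inj₁ refl) = stop (inj₁ refl)
      cQ (inj₁ refl) (inj₂ refl) = go (inj₁ refl) zv (stop (inj₂ refl))
      cQ (inj₂ refl) (inj₁ refl) = go (inj₂ refl) (symA S zv) (stop (inj₁ refl))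
      cQ (inj₂ refl) (inj₂ refl) = stop (inj₂ refl)

    S′ : Rooted N
    S′ = record
      { A = Quot (A S) (Merge Q (z S)) ; symA = Quot-sym (symA S) ; irrA = Quot-irr {F = Merge Q (z S)}
      ; free = Merge-free (inj₁ refl) cQ (free S) ; z = z S ; l = remV v (l S)
      ; z∉l = z∉l S ∘ proj₁ ∘ ∈-remove⁻ _≟_ v (l S)
      ; L = λ x → prune (D x) s₁ s₂ (L S x)
      ; uniq = λ x → prune-unique (D x) s₁ s₂ (uniq S x) }

    shrink : length (l S′) < length (l S)
    shrink = remove-shrinks _≟_ v∈l

    l′⁺ : ∀ {x} → x ∈ l S → x ≢ v → x ∈ l S′
    l′⁺ = ∈-remove⁺ _≟_

    l′⁻ : ∀ {x} → x ∈ l S′ → x ∈ l S × x ≢ v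
    l′⁻ = ∈-remove⁻ _≟_ v (l S)

    private
      ¬Q : ∀ {x} → x ∈ l S′ → ¬ Q x
      ¬Q x∈ (inj₁ e) = ≢z S (proj₁ (l′⁻ x∈)) e
      ¬Q x∈ (inj₂ e) = proj₂ (l′⁻ x∈) e

    A′⁺ : ∀ {x y} → x ∈ l S′ → y ∈ l S′ → A S x y → A S′ x y
    A′⁺ x∈ y∈ a = Merge-keeps (inj₁ refl) (⊥-elim ∘ ¬Q x∈) (⊥-elim ∘ ¬Q y∈) (λ { refl → irrA S a }) a

    A′z⁺ : ∀ {x} → x ∈ l S′ → A S (z S) x ⊎ A S v x → A S′ (z S) x
    A′z⁺ x∈ (inj₁ a) = symA S′ (Merge-root (inj₁ refl) (¬Q x∈) (inj₁ refl) (symA S a))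
    A′z⁺ x∈ (inj₂ a) = symA S′ (Merge-root (inj₁ refl) (¬Q x∈) (inj₂ refl) (symA S a))

    L′-boundary : ∀ {x} → A S (z S) x → L S′ x ≡ L S x
    L′-boundary {x} a with D x
    ... | yes (¬a , _) = ⊥-elim (¬a a)
    ... | no _ = refl

    -- A neighbour of `v` off the boundary loses at most two of its five colours, and the
    -- contraction puts it on the boundary, where three suffice.
    sizes′ : ∀ {Pre} → Sizes S Pre → Sizes S′ Pre
    sizes′ h {x} x∈ ¬pre with h (proj₁ (l′⁻ x∈)) ¬pre | D x | prune-length (D x) s₁ s₂ (uniq S x)
    ... | _ , five | yes (¬a , va) | len =
      ℕ.+-cancelˡ-≤ 2 _ _ (ℕ.≤-trans (five ¬a) len) , λ ¬a′ → ⊥-elim (¬a′ (A′z⁺ x∈ (inj₂ va)))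
    ... | three , five | no _ | _ = three , λ ¬a′ → five (¬a′ ∘ A′z⁺ x∈ ∘ inj₁)

    module _ (s₁∈ : s₁ ∈ L S v) (s₂∈ : s₂ ∈ L S v)
      (pick : ∀ (φ : Fin N → ℕ) → (∀ {x} → x ∈ l S → x ≢ v → φ x ∈ L S x) →
        ¬ ¬ (∃[ s ] ((s ≡ s₁ ⊎ s ≡ s₂) × (∀ {t} → t ∈ l S → A S (z S) t → A S v t → φ t ≢ s)))) where

      -- Neighbours of `v` off the boundary avoid both withheld colours, so only the boundary
      -- neighbours restrict the colour of `v`, and `pick` deals with them.
      unabsorb : Col S′ → ¬ ¬ Col S
      unabsorb (φ , inL , proper) k = pick φ inL₀ λ { (s , s∈ , avoid) → decide λ z? → k (done s s∈ avoid z?) }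
        where
        inL₀ : ∀ {x} → x ∈ l S → x ≢ v → φ x ∈ L S x
        inL₀ {x} x∈ ne = prune-⊆ (D x) s₁ s₂ (inL (l′⁺ x∈ ne))
        module _ (s : ℕ) (s∈ : s ≡ s₁ ⊎ s ≡ s₂) (avoid : ∀ {t} → t ∈ l S → A S (z S) t → A S v t → φ t ≢ s)
                 (z? : ∀ x → Dec (A S (z S) x)) where
          ψ : Fin N → ℕ
          ψ x with x ≟ v
          ... | yes _ = s
          ... | no _ = φ x
          clash : ∀ {x} → x ∈ l S → A S v x → φ x ≢ s
          clash {x} x∈ a with z? x
          ... | yes za = avoid x∈ za a
          ... | no ¬za = λ e →
            let ≢₁ , ≢₂ = prune-avoid (D x) s₁ s₂ (¬za , a) (inL (l′⁺ x∈ λ { refl → irrA S a })) in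
            [ (λ e₁ → ≢₁ (trans e e₁)) , (λ e₂ → ≢₂ (trans e e₂)) ]′ s∈
          done : Col S
          done = ψ , inψ , properψ
            where
            inψ : ∀ {x} → x ∈ l S → ψ x ∈ L S x
            inψ {x} x∈ with x ≟ v
            ... | no ne = inL₀ x∈ ne
            ... | yes refl = [ (λ e → subst (_∈ L S v) (sym e) s₁∈) , (λ e → subst (_∈ L S v) (sym e) s₂∈) ]′ s∈
            properψ : ∀ {x y} → x ∈ l S → y ∈ l S → A S x y → ψ x ≢ ψ y
            properψ {x} {y} x∈ y∈ a with x ≟ v | y ≟ v
            ... | yes refl | yes refl = ⊥-elim (irrA S a)
            ... | yes refl | no _ = ≢-sym (clash y∈ a)
            ... | no _ | yes refl = clash x∈ (symA S a)
            ... | no x≢ | no y≢ = proper (l′⁺ x∈ x≢) (l′⁺ y∈ y≢) (A′⁺ (l′⁺ x∈ x≢) (l′⁺ y∈ y≢) a)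

  -- The hypothesis of Thomassen's induction: an edge of the boundary is precoloured. Its ends stay
  -- in `l`, with singleton lists.
  record Pre₂ (S : Rooted N) (p q : Fin N) (c d : ℕ) : Set where
    field
      p∈ : p ∈ l S
      q∈ : q ∈ l S
      pq : A S p q
      zp : A S (z S) p
      zq : A S (z S) q
      Lp : L S p ≡ c ∷ []
      Lq : L S q ≡ d ∷ []
      c≢d : c ≢ d
      sizes : Sizes S (λ x → x ≡ p ⊎ x ≡ q)

  open Pre₂

  Solves₂ : ℕ → Set₁
  Solves₂ m = ∀ (S : Rooted N) → length (l S) ≤ m → ∀ {p q c d} → Pre₂ S p q c d → ¬ ¬ Col S

  -- Separation along two vertices.

  module _ (S : Rooted N) where

    -- One side of a separation: vertices of `X` no longer need colours, and a connected set `Q`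
    -- consisting of `r` and vertices of `X` is contracted to `r`, which inherits its edges.
    module Side (r : Fin N) (X Q : Fin N → Set) (X? : ∀ x → Dec (X x)) (r∈ : r ∈ l S) (¬Xr : ¬ X r)
      (Qr : Q r) (cQ : Conn (A S) Q) (Q⊆ : ∀ {x} → Q x → (x ∈ l S × X x) ⊎ x ≡ r)
      (L′ : Fin N → List ℕ) (uniq′ : ∀ x → Unique (L′ x)) where

      S′ : Rooted N
      S′ = record
        { A = Quot (A S) (Merge Q r) ; symA = Quot-sym (symA S) ; irrA = Quot-irr {F = Merge Q r}
        ; free = Merge-free Qr cQ (free S) ; z = z S ; l = filter (¬? ∘ X?) (l S)
        ; z∉l = z∉l S ∘ proj₁ ∘ ∈-filter⁻ (¬? ∘ X?) {xs = l S} ; L = L′ ; uniq = uniq′ }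

      l′⁺ : ∀ {x} → x ∈ l S → ¬ X x → x ∈ l S′
      l′⁺ = ∈-filter⁺ (¬? ∘ X?)

      l′⁻ : ∀ {x} → x ∈ l S′ → x ∈ l S × ¬ X x
      l′⁻ = ∈-filter⁻ (¬? ∘ X?) {xs = l S}

      shrink : ∀ {x} → x ∈ l S → X x → length (l S′) < length (l S)
      shrink x∈ Xx = filter-notAll (¬? ∘ X?) (l S) (lose x∈ (λ ¬Xx → ¬Xx Xx))

      private
        Q-only : ∀ {x} → x ∈ l S′ → Q x → x ≡ r
        Q-only x∈ q = [ (λ (_ , Xx) → ⊥-elim (proj₂ (l′⁻ x∈) Xx)) , id ]′ (Q⊆ q)
        ¬Qz : ¬ Q (z S)
        ¬Qz q = [ (λ (z∈ , _) → z∉l S z∈) , (λ { refl → z∉l S r∈ }) ]′ (Q⊆ q)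

      A′⁺ : ∀ {x y} → x ∈ l S′ → y ∈ l S′ → A S x y → A S′ x y
      A′⁺ x∈ y∈ a = Merge-keeps Qr (Q-only x∈) (Q-only y∈) (λ { refl → irrA S a }) a

      A′z⁺ : ∀ {x} → x ∈ l S′ → A S (z S) x → A S′ (z S) x
      A′z⁺ x∈ a = Merge-keeps Qr (⊥-elim ∘ ¬Qz) (Q-only x∈) (λ { refl → irrA S a }) a

      zr : ∀ {q} → Q q → A S (z S) q → A S′ (z S) r
      zr = Merge-root Qr ¬Qz

      vr : ∀ {v q} → v ∈ l S′ → v ≢ r → Q q → A S v q → A S′ v r
      vr v∈ v≢r = Merge-root Qr (v≢r ∘ Q-only v∈)

    -- Two sides that meet only in v and r; contracting each to r makes vr an edge at the boundary of the other.
    separate : ∀ {m p q c d} → Solves₂ m → length (l S) ≤ suc m → Pre₂ S p q c d →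
      ∀ {v r} (X₁ X₂ Q₁ Q₂ : Fin N → Set) → (∀ x → Dec (X₁ x)) → (∀ x → Dec (X₂ x)) →
      v ∈ l S → r ∈ l S → v ≢ r → v ≢ p → v ≢ q → A S (z S) v →
      ¬ X₁ v → ¬ X₁ r → ¬ X₂ v → ¬ X₂ r →
      (∀ {x} → x ∈ l S → ¬ X₁ x → ¬ X₂ x → x ≡ v ⊎ x ≡ r) →
      (∀ {x y} → X₁ x → X₂ y → ¬ A S x y) →
      Disj X₁ X₂ → ¬ X₂ p → ¬ X₂ q →
      Conn (A S) Q₁ → Conn (A S) Q₂ → Q₁ r → Q₂ r →
      (∀ {x} → Q₁ x → (x ∈ l S × X₁ x) ⊎ x ≡ r) → (∀ {x} → Q₂ x → (x ∈ l S × X₂ x) ⊎ x ≡ r) →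
      ∃[ x ] (Q₁ x × A S (z S) x × A S v x) → ∃[ x ] (Q₂ x × A S (z S) x × A S v x) →
      ∃[ x ] (x ∈ l S × X₁ x) → ∃[ x ] (x ∈ l S × X₂ x) →
      ¬ ¬ Col S
    separate {m} {p} {q} {c} {d} solve len pre {v} {r} X₁ X₂ Q₁ Q₂ X₁? X₂? v∈ r∈ v≢r v≢p v≢q zv
      ¬X₁v ¬X₁r ¬X₂v ¬X₂r cover noedge dX ¬X₂p ¬X₂q cQ₁ cQ₂ Q₁r Q₂r Q₁⊆ Q₂⊆
      (q₁ , Q₁q , zq₁ , vq₁) (q₂ , Q₂q , zq₂ , vq₂) (x₁ , x₁∈ , X₁x) (x₂ , x₂∈ , X₂x) k =
      -- The side of `p` and `q` is coloured first; its colours at `v` and `r` then precolour the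
      -- other side.
      solve I.S′ (ℕ.≤-pred (ℕ.≤-trans (I.shrink x₂∈ X₂x) len)) pre₁ second
      where
      module I = Side r X₂ Q₂ X₂? r∈ ¬X₂r Q₂r cQ₂ Q₂⊆ (L S) (uniq S)
      pre₁ : Pre₂ I.S′ p q c d
      pre₁ = record
        { p∈ = p∈₁ ; q∈ = q∈₁ ; pq = I.A′⁺ p∈₁ q∈₁ (pq pre) ; zp = I.A′z⁺ p∈₁ (zp pre)
        ; zq = I.A′z⁺ q∈₁ (zq pre) ; Lp = Lp pre ; Lq = Lq pre ; c≢d = c≢d pre
        ; sizes = λ x∈ ¬pre → let three , five = sizes pre (proj₁ (I.l′⁻ x∈)) ¬pre in
                    three , λ ¬a → five (¬a ∘ I.A′z⁺ x∈) }
        where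
        p∈₁ = I.l′⁺ (p∈ pre) ¬X₂p
        q∈₁ = I.l′⁺ (q∈ pre) ¬X₂q
      v∈₁ = I.l′⁺ v∈ ¬X₂v
      r∈₁ = I.l′⁺ r∈ ¬X₂r
      second : ¬ Col I.S′
      second (φ , inφ , properφ) =
        solve II.S′ (ℕ.≤-pred (ℕ.≤-trans (II.shrink x₁∈ X₁x) len)) pre₂ (k ∘ combine)
        where
        L₂ = assign (assign (L S) v (φ v)) r (φ r)
        L₂v : L₂ v ≡ φ v ∷ []
        L₂v = trans (assign-≢ v≢r) (assign-≡ {L = L S} {p = v})
        L₂r : L₂ r ≡ φ r ∷ []
        L₂r = assign-≡ {L = assign (L S) v (φ v)} {p = r}
        L₂x : ∀ {x} → x ≢ v → x ≢ r → L₂ x ≡ L S x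
        L₂x nv nr = trans (assign-≢ nr) (assign-≢ nv)
        module II = Side r X₁ Q₁ X₁? r∈ ¬X₁r Q₁r cQ₁ Q₁⊆ L₂ (assign-unique (assign-unique (uniq S)))
        v∈₂ = II.l′⁺ v∈ ¬X₁v
        r∈₂ = II.l′⁺ r∈ ¬X₁r
        not-pre : ∀ {x} → X₂ x → ¬ (x ≡ p ⊎ x ≡ q)
        not-pre Xx (inj₁ refl) = ¬X₂p Xx
        not-pre Xx (inj₂ refl) = ¬X₂q Xx
        pre₂ : Pre₂ II.S′ v r (φ v) (φ r)
        pre₂ = record
          { p∈ = v∈₂ ; q∈ = r∈₂ ; pq = II.vr v∈₂ v≢r Q₁q vq₁ ; zp = II.A′z⁺ v∈₂ zv
          ; zq = II.zr Q₁q zq₁ ; Lp = L₂v ; Lq = L₂r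
          -- The contraction of `Q₂` makes `vr` an edge of the first side, so its ends received
          -- different colours.
          ; c≢d = properφ v∈₁ r∈₁ (I.vr v∈₁ v≢r Q₂q vq₂)
          ; sizes = sizes₂ }
          where
          sizes₂ : Sizes II.S′ (λ x → x ≡ v ⊎ x ≡ r)
          sizes₂ {x} x∈ ¬pre with X₂? x
          ... | no ¬X₂x = ⊥-elim (¬pre (cover (proj₁ (II.l′⁻ x∈)) (proj₂ (II.l′⁻ x∈)) ¬X₂x))
          ... | yes X₂x with sizes pre (proj₁ (II.l′⁻ x∈)) (not-pre X₂x)
          ... | three , five rewrite L₂x (¬pre ∘ inj₁) (¬pre ∘ inj₂) =
            three , λ ¬a → five (¬a ∘ II.A′z⁺ x∈)
        combine : Col II.S′ → Col S
        combine (ψ , inψ , properψ) = χ , inχ , properχ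
          where
          χ : Fin N → ℕ
          χ x with X₂? x
          ... | yes _ = ψ x
          ... | no _ = φ x
          ∈₂ : ∀ {x} → x ∈ l S → X₂ x → x ∈ l II.S′
          ∈₂ x∈ X₂x = II.l′⁺ x∈ (λ X₁x → dX X₁x X₂x)
          inχ : ∀ {x} → x ∈ l S → χ x ∈ L S x
          inχ {x} x∈ with X₂? x
          ... | yes X₂x = subst (ψ x ∈_) (L₂x (λ { refl → ¬X₂v X₂x }) (λ { refl → ¬X₂r X₂x })) (inψ (∈₂ x∈ X₂x))
          ... | no ¬X₂x = inφ (I.l′⁺ x∈ ¬X₂x)
          -- A neighbour of `X₂` outside `X₂` can only be `v` or `r`, where the singleton lists make
          -- the two colourings agree.
          across : ∀ {x y} → x ∈ l S → y ∈ l S → X₂ x → ¬ X₂ y → A S x y → ψ x ≢ φ y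
          across {x} {y} x∈ y∈ X₂x ¬X₂y a with X₁? y
          ... | yes X₁y = ⊥-elim (noedge X₁y X₂x (symA S a))
          ... | no ¬X₁y with cover y∈ ¬X₁y ¬X₂y
          ... | inj₁ refl = λ e → properψ (∈₂ x∈ X₂x) v∈₂ (II.A′⁺ (∈₂ x∈ X₂x) v∈₂ a)
                              (trans e (sym (∈-singleton L₂v (inψ v∈₂))))
          ... | inj₂ refl = λ e → properψ (∈₂ x∈ X₂x) r∈₂ (II.A′⁺ (∈₂ x∈ X₂x) r∈₂ a)
                              (trans e (sym (∈-singleton L₂r (inψ r∈₂))))
          properχ : ∀ {x y} → x ∈ l S → y ∈ l S → A S x y → χ x ≢ χ y
          properχ {x} {y} x∈ y∈ a with X₂? x | X₂? y
          ... | yes Xx | yes Xy = properψ (∈₂ x∈ Xx) (∈₂ y∈ Xy) (II.A′⁺ (∈₂ x∈ Xx) (∈₂ y∈ Xy) a)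
          ... | yes Xx | no ¬Xy = across x∈ y∈ Xx ¬Xy a
          ... | no ¬Xx | yes Xy = ≢-sym (across y∈ x∈ Xy ¬Xx (symA S a))
          ... | no ¬Xx | no ¬Xy = properφ (I.l′⁺ x∈ ¬Xx) (I.l′⁺ y∈ ¬Xy)
                                    (I.A′⁺ (I.l′⁺ x∈ ¬Xx) (I.l′⁺ y∈ ¬Xy) a)

  swap-pre : ∀ {S : Rooted N} {p q c d} → Pre₂ S p q c d → Pre₂ S q p d c
  swap-pre {S = S} pre = record
    { p∈ = q∈ pre ; q∈ = p∈ pre ; pq = symA S (pq pre) ; zp = zq pre ; zq = zp pre
    ; Lp = Lq pre ; Lq = Lp pre ; c≢d = ≢-sym (c≢d pre)
    ; sizes = λ x∈ h → sizes pre x∈ λ { (inj₁ e) → h (inj₂ e) ; (inj₂ e) → h (inj₁ e) } }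

  -- Separations and K₅ models around a boundary neighbour of p.

  module Around {m : ℕ} (solve : Solves₂ m) (S : Rooted N) (len : length (l S) ≤ suc m)
    {p q : Fin N} {c d : ℕ} (pre : Pre₂ S p q c d)
    {v : Fin N} (v∈ : v ∈ l S) (zv : A S (z S) v) (pv : A S p v) (v≢q : v ≢ q) where

    v≢p : v ≢ p
    v≢p refl = irrA S pv

    Avoiding : Fin N → Set
    Avoiding x = x ∈ l S × x ≢ v × x ≢ p

    -- Here `v` and `p` separate `t` from `q`. As `vp` is an edge already, nothing has to be
    -- contracted, and both sets `Q` consist of `p` alone.
    cut-off : ∀ {t} → Avoiding t → ¬ Path (A S) Avoiding t q → ¬ ¬ Col S
    cut-off {t} Rt ¬tq k = decide λ Comp? → decide λ X₁? →
      separate S solve len pre X₁ Comp (_≡ p) (_≡ p) X₁? Comp? v∈ (p∈ pre) v≢p v≢p v≢q zv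
        (λ (_ , ne , _) → ne refl) (λ (_ , _ , ne , _) → ne refl)
        (λ w → proj₁ (proj₂ (target w)) refl) (λ w → proj₂ (proj₂ (target w)) refl)
        (cover Comp?) (λ { (x∈ , x≢v , x≢p , ¬Kx) Ky a → ¬Kx (snoc Ky (symA S a) (x∈ , x≢v , x≢p)) })
        (λ (_ , _ , _ , ¬Kx) → ¬Kx) (λ w → proj₂ (proj₂ (target w)) refl) ¬tq
        (single-conn p) (single-conn p) refl refl inj₂ inj₂
        (p , refl , zp pre , symA S pv) (p , refl , zp pre , symA S pv)
        (q , q∈ pre , q∈ pre , ≢-sym v≢q , (λ { refl → irrA S (pq pre) }) , ¬tq)
        (t , proj₁ Rt , stop Rt) k
      where
      Comp X₁ : Fin N → Set
      Comp = Path (A S) Avoiding t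
      X₁ x = x ∈ l S × x ≢ v × x ≢ p × ¬ Comp x
      cover : (∀ x → Dec (Comp x)) → ∀ {x} → x ∈ l S → ¬ X₁ x → ¬ Comp x → x ≡ v ⊎ x ≡ p
      cover Comp? {x} x∈ ¬X ¬Comp with x ≟ v | x ≟ p
      ... | yes e | _ = inj₁ e
      ... | no _ | yes e = inj₂ e
      ... | no nv | no np = ⊥-elim (¬X (x∈ , nv , np , ¬Comp))

    -- `z`, `v`, `p`, `q` are pairwise adjacent, and the component of `t` off `v`, `p`, `q` is the
    -- fifth branch set: it meets `z` and `v` at `t`, and `p` and `q` through the two paths.
    triangle : ∀ {t} → Avoiding t → t ≢ q → A S (z S) t → A S v t → A S v q →
      Path (A S) Avoiding t q → Path (A S) (λ x → x ∈ l S × x ≢ v × x ≢ q) t p → ⊥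
    triangle {t} (t∈ , t≢v , t≢p) t≢q zt vt vq tq tp = free S
      (mkK5 (symA S) (_≡ z S) (_≡ v) (_≡ p) (_≡ q) Comp
        (single-conn _) (single-conn _) (single-conn _) (single-conn _) (comp-conn (symA S))
        (pair (≢-sym (≢z S v∈)) zv) (pair (≢-sym (≢z S (p∈ pre))) (zp pre))
        (pair (≢-sym (≢z S (q∈ pre))) (zq pre))
        ((λ { refl Kz → z∉l S (proj₁ (target Kz)) }) , z S , t , refl , Kt , zt)
        (pair v≢p (symA S pv)) (pair v≢q vq)
        ((λ { refl Kv → proj₁ (proj₂ (target Kv)) refl }) , v , t , refl , Kt , vt)
        (pair (λ { refl → irrA S (pq pre) }) (pq pre))
        ((λ { refl Kp → proj₁ (proj₂ (proj₂ (target Kp))) refl }) , touch-p)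
        ((λ { refl Kq → proj₂ (proj₂ (proj₂ (target Kq))) refl }) , touch-q))
      where
      pair : ∀ {x y} → x ≢ y → A S x y → Sep (symA S) (_≡ x) (_≡ y)
      pair ne a = (λ { refl e → ne e }) , _ , _ , refl , refl , a
      Comp : Fin N → Set
      Comp = Path (A S) (λ x → x ∈ l S × x ≢ v × x ≢ p × x ≢ q) t
      Kt : Comp t
      Kt = stop (t∈ , t≢v , t≢p , t≢q)
      touch-p : Touch (A S) (_≡ p) Comp
      touch-p with cross (_≟ p) tp t≢p refl
      ... | a , _ , w , _ , refl , ap =
        p , a , refl , mapP (λ ((x∈ , nv , nq) , np) → x∈ , nv , np , nq) w , symA S ap
      touch-q : Touch (A S) (_≡ q) Comp
      touch-q with cross (_≟ q) tq t≢q refl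
      ... | a , _ , w , _ , refl , aq =
        q , a , refl , mapP (λ ((x∈ , nv , np) , nq) → x∈ , nv , np , nq) w , symA S aq

    -- Take a path `vs` from `t₁` to `t₂` and the component `Z` of `p` off `v` and `vs`. If `Z`
    -- touches two disjoint pieces of the path, these pieces with `Z`, `z` and `v` form a K₅ model;
    -- otherwise `Z` is attached to the path at a single vertex `r`, and `v` and `r` separate.
    fork : ∀ {t₁ t₂} → Avoiding t₁ → Avoiding t₂ → t₁ ≢ t₂ → A S (z S) t₁ → A S (z S) t₂ →
      A S v t₁ → A S v t₂ → Path (A S) Avoiding t₁ t₂ → Path (A S) Avoiding t₁ q → ¬ ¬ Col S
    fork {t₁} {t₂} R₁ R₂ t₁≢t₂ zt₁ zt₂ vt₁ vt₂ t₁t₂ t₁q k =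
      decide λ Z? → decide λ X₂? → decide λ T? → main Z? X₂? T? (split (symA S) T? sp)
      where
      open import Data.List.Membership.DecPropositional (_≟_ {N}) using (_∈?_)
      vs : List (Fin N)
      vs = proj₁ (simple t₁t₂)
      sp : SPath (A S) t₁ t₂ vs
      sp = proj₁ (proj₂ (simple t₁t₂))
      vs⊆ : ∀ {w} → w ∈ vs → Avoiding w
      vs⊆ = proj₂ (proj₂ (simple t₁t₂))
      Off Z X₂ T : Fin N → Set
      Off x = x ∈ l S × x ≢ v × x ∉ vs
      Z = Path (A S) Off p
      X₂ x = x ∈ l S × x ≢ v × ¬ Z x × x ∉ vs ⊎ x ∈ vs × ¬ T x
      T y = ∃[ x ] (Z x × A S x y)
      Zp : Z p
      Zp = stop (p∈ pre , ≢-sym v≢p , λ p∈vs → proj₂ (proj₂ (vs⊆ p∈vs)) refl)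
      extend : ∀ {x y} → Z x → A S x y → y ∈ l S → y ≢ v → y ∉ vs → Z y
      extend w a y∈ y≢v y∉ = snoc w a (y∈ , y≢v , y∉)
      q-side : Z q ⊎ q ∈ vs
      q-side with q ∈? vs
      ... | yes q∈vs = inj₂ q∈vs
      ... | no q∉ = inj₁ (extend Zp (pq pre) (q∈ pre) (≢-sym v≢q) q∉)
      -- If `q` is on the path, the edge `pq` suffices. Otherwise `q` belongs to `Z`, and the path
      -- between `t₁` and `q` leads from `Z` to `vs`.
      touched : ∃[ y ] (y ∈ vs × T y)
      touched with q-side
      ... | inj₂ q∈vs = q , q∈vs , p , Zp , pq pre
      ... | inj₁ Zq with cross (_∈? vs) (reverse (symA S) t₁q)
                           (proj₂ (proj₂ (target Zq))) (first∈ sp)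
      ... | a , b , w , _ , b∈ , ab = b , b∈ , a , Zq ++P mapP (λ ((x∈ , nv , _) , n) → x∈ , nv , n) w , ab
      main : (∀ x → Dec (Z x)) → (∀ x → Dec (X₂ x)) → (∀ x → Dec (T x)) →
        Split {A = A S} t₁ t₂ vs T ⊎ (∃[ r ] (r ∈ vs × ∀ {x} → x ∈ vs → T x → x ≡ r)) → ⊥
      main Z? X₂? T? (inj₁ σ) = free S
        (rooted-K5 (symA S) (≢-sym (≢z S v∈)) zv (comp-conn (symA S)) (λ w x∈ → proj₂ (proj₂ (target w)) x∈)
          (λ w → z∉l S (proj₁ (target w))) (λ w → proj₁ (proj₂ (target w)) refl)
          (λ z∈ → z∉l S (proj₁ (vs⊆ z∈))) (λ v∈vs → proj₁ (proj₂ (vs⊆ v∈vs)) refl)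
          Zp (zp pre) (symA S pv) zt₁ vt₁ zt₂ vt₂ σ)
      -- The first side is `Z`, contracted into `r`; the second is everything else, and there the
      -- whole path is contracted to `r`.
      main Z? X₂? T? (inj₂ (r , r∈vs , only)) =
        separate S solve len pre Z X₂ Q₁ (_∈ vs) Z? X₂? v∈ (proj₁ (vs⊆ r∈vs)) (λ { refl → v∉vs r∈vs }) v≢p v≢q zv
          (λ w → proj₁ (proj₂ (target w)) refl) (λ w → proj₂ (proj₂ (target w)) r∈vs)
          (λ { (inj₁ (_ , ne , _)) → ne refl ; (inj₂ (v∈vs , _)) → v∉vs v∈vs })
          (λ { (inj₁ (_ , _ , _ , r∉)) → r∉ r∈vs ; (inj₂ (_ , ¬Tr)) → ¬Tr Tr })
          cover noedge (λ { w (inj₁ (_ , _ , ¬Z , _)) → ¬Z w ; w (inj₂ (x∈ , _)) → proj₂ (proj₂ (target w)) x∈ })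
          (λ { (inj₁ (_ , _ , ¬Z , _)) → ¬Z Zp ; (inj₂ (p∈vs , _)) → proj₂ (proj₂ (vs⊆ p∈vs)) refl })
          (λ { (inj₁ (_ , _ , ¬Zq , q∉)) → [ ¬Zq , q∉ ]′ q-side
             ; (inj₂ (q∈vs , ¬Tq)) → ¬Tq (p , Zp , pq pre) })
          cQ₁ (spath-conn (symA S) sp) (inj₂ refl) r∈vs Q₁⊆ Q₂⊆
          (p , inj₁ Zp , zp pre , symA S pv) (t₁ , first∈ sp , zt₁ , vt₁)
          (p , p∈ pre , Zp) far k
        where
        v∉vs : v ∉ vs
        v∉vs v∈vs = proj₁ (proj₂ (vs⊆ v∈vs)) refl
        Tr : T r
        Tr = let y , y∈ , Ty = touched in subst T (only y∈ Ty) Ty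
        untouched : ∀ {x} → x ∈ vs → x ≢ r → X₂ x
        untouched x∈ x≢r = inj₂ (x∈ , x≢r ∘ only x∈)
        cover : ∀ {x} → x ∈ l S → ¬ Z x → ¬ X₂ x → x ≡ v ⊎ x ≡ r
        cover {x} x∈ ¬Z ¬X with x ≟ v | x ∈? vs | x ≟ r
        ... | yes e | _ | _ = inj₁ e
        ... | no _ | _ | yes e = inj₂ e
        ... | no nv | yes x∈vs | no nr = ⊥-elim (¬X (untouched x∈vs nr))
        ... | no nv | no x∉vs | no nr = ⊥-elim (¬X (inj₁ (x∈ , nv , ¬Z , x∉vs)))
        noedge : ∀ {x y} → Z x → X₂ y → ¬ A S x y
        noedge w (inj₁ (y∈ , y≢v , ¬Zy , y∉)) a = ¬Zy (extend w a y∈ y≢v y∉)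
        noedge w (inj₂ (y∈ , ¬Ty)) a = ¬Ty (_ , w , a)
        Q₁ : Fin N → Set
        Q₁ x = Z x ⊎ x ≡ r
        toZ : ∀ {x} → Q₁ x → Path (A S) Q₁ p x
        toZ (inj₁ w) = mapP inj₁ (reach w)
        toZ (inj₂ refl) = let x , w , a = Tr in snoc (mapP inj₁ (reach w)) a (inj₂ refl)
        cQ₁ : Conn (A S) Q₁
        cQ₁ x y = reverse (symA S) (toZ x) ++P toZ y
        Q₁⊆ : ∀ {x} → Q₁ x → (x ∈ l S × Z x) ⊎ x ≡ r
        Q₁⊆ (inj₁ w) = inj₁ (proj₁ (target w) , w)
        Q₁⊆ (inj₂ e) = inj₂ e
        Q₂⊆ : ∀ {x} → x ∈ vs → (x ∈ l S × X₂ x) ⊎ x ≡ r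
        Q₂⊆ {x} x∈ with x ≟ r
        ... | yes e = inj₂ e
        ... | no ne = inj₁ (proj₁ (vs⊆ x∈) , untouched x∈ ne)
        -- The ends of the path differ, so one of them is not `r`; hence the second side is not
        -- empty.
        far : ∃[ x ] (x ∈ l S × X₂ x)
        far with t₁ ≟ r
        ... | no ne = t₁ , proj₁ R₁ , untouched (first∈ sp) ne
        ... | yes refl = t₂ , proj₁ R₂ , untouched (last∈ sp) (≢-sym t₁≢t₂)

  -- The induction with zero, one or two precoloured vertices.

  record Pre₁ (S : Rooted N) (p : Fin N) (c : ℕ) : Set where
    field
      p∈ : p ∈ l S
      zp : A S (z S) p
      Lp : L S p ≡ c ∷ []
      sizes : Sizes S (_≡ p)

  another : ∀ {S : Rooted N} {x} cs → length cs < length (L S x) → ∃[ c ] (c ∈ L S x × c ∉ cs)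
  another {S = S} {x} = ∃-∉ ℕ._≟_ (uniq S x)

  module _ (S : Rooted N) (p : Fin N) (c : ℕ) where

    precolour : Rooted N
    precolour = record { A = A S ; symA = symA S ; irrA = irrA S ; free = free S ; z = z S ; l = l S
                       ; z∉l = z∉l S ; L = assign (L S) p c ; uniq = assign-unique (uniq S) }

    unprecolour : c ∈ L S p → Col precolour → Col S
    unprecolour c∈ (φ , inL , proper) = φ , (λ x∈ → assign-⊆ {L = L S} {p} {c} c∈ (inL x∈)) , proper

    precolour-sizes : ∀ {Pre Pre′ : Fin N → Set} → Pre′ p → (∀ {x} → Pre x → Pre′ x) →
      Sizes S Pre → Sizes precolour Pre′
    precolour-sizes pre′p mono h {x} x∈ ¬pre = subst (λ xs → 3 ≤ length xs × (¬ A S (z S) x → 5 ≤ length xs))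
      (sym (assign-≢ {L = L S} {p} {c} (λ { refl → ¬pre pre′p }))) (h x∈ (¬pre ∘ mono))

  nil-col : (S : Rooted N) → (∀ {x} → x ∉ l S) → Col S
  nil-col S none = (λ _ → 0) , (λ x∈ → ⊥-elim (none x∈)) , λ x∈ → ⊥-elim (none x∈)

  -- The index counts precoloured vertices, and `m` bounds the length of `l`. Precolouring one more
  -- vertex keeps `m`; deletions and separations lower it.
  solve₀ : ∀ m (S : Rooted N) → length (l S) ≤ m → Sizes S (λ _ → ⊥) → ¬ ¬ Col S
  solve₁ : ∀ m (S : Rooted N) → length (l S) ≤ m → ∀ {p c} → Pre₁ S p c → ¬ ¬ Col S
  solve₂ : ∀ m → Solves₂ m

  -- All colours are still available off the boundary, so if the boundary is empty any vertex can become the root.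
  reroot : ∀ m (S : Rooted N) → length (l S) ≤ suc m → Sizes S (λ _ → ⊥) →
    (∀ {x} → x ∈ l S → ¬ A S (z S) x) → ∀ {v} → v ∈ l S → ¬ ¬ Col S

  solve₀ zero S len _ k = k (nil-col S (≤0-nil len))
  solve₀ (suc m) S len sizes k = by-cases (∃[ p ] (p ∈ l S × A S (z S) p))
    (λ (p , p∈ , zp) → let c , c∈ , _ = another {S = S} [] (ℕ.<-≤-trans (s≤s z≤n) (proj₁ (sizes p∈ λ ()))) in
      solve₁ (suc m) (precolour S p c) len
        (record { p∈ = p∈ ; zp = zp ; Lp = assign-≡ {L = L S} {p = p}
                ; sizes = precolour-sizes S p c {λ _ → ⊥} {_≡ p} refl (λ ()) sizes })
        (k ∘ unprecolour S p c c∈))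
    (λ none → by-cases (∃[ v ] v ∈ l S)
      (λ (v , v∈) → reroot m S len sizes (λ x∈ zx → none (_ , x∈ , zx)) v∈ k)
      (λ empty → k (nil-col S (λ x∈ → empty (_ , x∈)))))

  reroot m S len sizes none {v} v∈ k = decide λ D →
    let c , c∈ , _ = another {S = S} [] (ℕ.<-≤-trans (s≤s z≤n) (proj₁ (sizes v∈ λ ())))
    in finish c c∈ D
    where
    module _ (c : ℕ) (c∈ : c ∈ L S v) (D : ∀ x → Dec (A S v x)) where
      l⁻ : ∀ {x} → x ∈ remV v (l S) → x ∈ l S × x ≢ v
      l⁻ = ∈-remove⁻ _≟_ v (l S)
      S′ : Rooted N
      S′ = record { A = A S ; symA = symA S ; irrA = irrA S ; free = free S ; z = v ; l = remV v (l S)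
                  ; z∉l = λ v∈ → proj₂ (l⁻ v∈) refl
                  ; L = λ x → prune (D x) c c (L S x) ; uniq = λ x → prune-unique (D x) c c (uniq S x) }
      sizes′ : Sizes S′ (λ _ → ⊥)
      sizes′ {x} x∈ _ with proj₂ (sizes (proj₁ (l⁻ x∈)) λ ()) (none (proj₁ (l⁻ x∈))) | D x
                         | prune-length (D x) c c (uniq S x)
      ... | five | yes vx | len = ℕ.+-cancelˡ-≤ 2 _ _ (ℕ.≤-trans five len) , λ ¬vx → ⊥-elim (¬vx vx)
      ... | five | no _ | _ = ℕ.≤-trans (s≤s (s≤s (s≤s z≤n))) five , λ _ → five
      extend : Col S′ → Col S
      extend (φ , inL , proper) = ψ , inψ , properψ
        where
        ψ : Fin N → ℕ
        ψ x with x ≟ v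
        ... | yes _ = c
        ... | no _ = φ x
        clash : ∀ {x} → x ∈ l S → A S v x → φ x ≢ c
        clash {x} x∈ a = proj₁ (prune-avoid (D x) c c a (inL (∈-remove⁺ _≟_ x∈ λ { refl → irrA S a })))
        inψ : ∀ {x} → x ∈ l S → ψ x ∈ L S x
        inψ {x} x∈ with x ≟ v
        ... | yes refl = c∈
        ... | no ne = prune-⊆ (D x) c c (inL (∈-remove⁺ _≟_ x∈ ne))
        properψ : ∀ {x y} → x ∈ l S → y ∈ l S → A S x y → ψ x ≢ ψ y
        properψ {x} {y} x∈ y∈ a with x ≟ v | y ≟ v
        ... | yes refl | yes refl = ⊥-elim (irrA S a)
        ... | yes refl | no _ = ≢-sym (clash y∈ a)
        ... | no _ | yes refl = clash x∈ (symA S a)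
        ... | no nx | no ny = proper (∈-remove⁺ _≟_ x∈ nx) (∈-remove⁺ _≟_ y∈ ny) a
      finish : ⊥
      finish = solve₀ m S′ (ℕ.≤-pred (ℕ.≤-trans (remove-shrinks _≟_ v∈) len)) sizes′ (k ∘ extend)

  solve₁ zero S len _ k = k (nil-col S (≤0-nil len))
  solve₁ (suc m) S len {p} {c} pre k = by-cases (∃[ v ] (v ∈ l S × A S (z S) v × A S p v))
    (λ (v , v∈ , zv , pv) →
      let v≢p = λ { refl → irrA S pv }
          d , d∈ , d∉ = another {S = S} (c ∷ []) (ℕ.<-≤-trans (s≤s (s≤s z≤n)) (proj₁ (Pre₁.sizes pre v∈ v≢p)))
      in solve₂ (suc m) (precolour S v d) len
        (record { p∈ = Pre₁.p∈ pre ; q∈ = v∈ ; pq = pv ; zp = Pre₁.zp pre ; zq = zv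
                ; Lp = trans (assign-≢ (≢-sym v≢p)) (Pre₁.Lp pre) ; Lq = assign-≡ {L = L S} {p = v}
                ; c≢d = λ e → d∉ (here (sym e))
                ; sizes = precolour-sizes S v d {_≡ p} {λ x → x ≡ p ⊎ x ≡ v} (inj₂ refl) inj₁ (Pre₁.sizes pre) })
        (k ∘ unprecolour S v d d∈))
    -- No boundary neighbour of `p` exists, so `p` is deleted with its only colour `c` withheld.
    (λ none → decide λ D →
      let module M = Absorb S p (Pre₁.p∈ pre) (Pre₁.zp pre) c c D
          c∈ = subst (c ∈_) (sym (Pre₁.Lp pre)) (here refl)
      in solve₀ m M.S′ (ℕ.≤-pred (ℕ.≤-trans M.shrink len))
        (λ x∈ _ → M.sizes′ {_≡ p} (Pre₁.sizes pre) x∈ (proj₂ (M.l′⁻ x∈)))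
        (λ col → M.unabsorb c∈ c∈
          (λ φ _ k′ → k′ (c , inj₁ refl , λ t∈ zt pt → ⊥-elim (none (_ , t∈ , zt , pt)))) col k))

  solve₂ zero S len _ k = k (nil-col S (≤0-nil len))
  solve₂ (suc m) S len {p} {q} {c} {d} pre k =
    by-cases (∃[ v ] (v ∈ l S × A S (z S) v × A S p v × v ≢ q)) inner isolated
    where
    q≢p : q ≢ p
    q≢p refl = irrA S (pq pre)

    -- The only boundary neighbour of `p` is `q`, whose colour is not `c`. So `p` is deleted and `q`
    -- stays precoloured.
    isolated : ¬ (∃[ v ] (v ∈ l S × A S (z S) v × A S p v × v ≢ q)) → ⊥
    isolated none = decide λ D →
      let module M = Absorb S p (p∈ pre) (zp pre) c c D
          c∈ = subst (c ∈_) (sym (Lp pre)) (here refl)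
      in solve₁ m M.S′ (ℕ.≤-pred (ℕ.≤-trans M.shrink len))
        (record { p∈ = M.l′⁺ (q∈ pre) q≢p ; zp = M.A′z⁺ (M.l′⁺ (q∈ pre) q≢p) (inj₁ (zq pre))
                ; Lp = trans (M.L′-boundary (zq pre)) (Lq pre)
                ; sizes = λ x∈ ≢q → M.sizes′ {λ x → x ≡ p ⊎ x ≡ q} (sizes pre) x∈ [ proj₂ (M.l′⁻ x∈) , ≢q ]′ })
        (λ col → M.unabsorb c∈ c∈ (λ φ inL k′ → k′ (c , inj₁ refl , pick φ inL)) col k)
      where
      pick : ∀ (φ : Fin N → ℕ) → (∀ {x} → x ∈ l S → x ≢ p → φ x ∈ L S x) →
        ∀ {t} → t ∈ l S → A S (z S) t → A S p t → φ t ≢ c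
      pick φ inL {t} t∈ zt pt with t ≟ q
      ... | no ne = ⊥-elim (none (t , t∈ , zt , pt , ne))
      ... | yes refl = λ e → c≢d pre (trans (sym e) (∈-singleton (Lq pre) (inL (q∈ pre) q≢p)))

    -- The cases count the boundary neighbours `t` of `v` other than `p` and `q`. Two of them, or
    -- one together with the edge `vq`, give a separation or a K₅ model; in the other cases `v` can
    -- be deleted.
    inner : ∃[ v ] (v ∈ l S × A S (z S) v × A S p v × v ≢ q) → ⊥
    inner (v , v∈ , zv , pv , v≢q) =
      by-cases (∃[ t₁ ] ∃[ t₂ ] (Inner t₁ × Inner t₂ × t₁ ≢ t₂))
        (λ { (t₁ , t₂ , (R₁ , ≢q₁ , zt₁ , vt₁) , (R₂ , ≢q₂ , zt₂ , vt₂) , ne) →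
          em λ { (no ¬t₁q) → M.cut-off R₁ ¬t₁q k ; (yes t₁q) →
          em λ { (no ¬t₂q) → M.cut-off R₂ ¬t₂q k ; (yes t₂q) →
          M.fork R₁ R₂ ne zt₁ zt₂ vt₁ vt₂ (t₁q ++P reverse (symA S) t₂q) t₁q k } } })
        (λ ¬two → by-cases (∃[ t ] Inner t)
          (λ (t , It) → by-cases (A S v q) (three It) (one ¬two It))
          (λ none → absorb₀ none))
      where
      module M = Around (solve₂ m) S len pre v∈ zv pv v≢q
      Inner : Fin N → Set
      Inner t = M.Avoiding t × t ≢ q × A S (z S) t × A S v t

      -- Now `p` and `q` play symmetric parts: either one of them separates together with `v`, or
      -- `t` is joined to both as `triangle` requires.
      three : ∀ {t} → Inner t → A S v q → ⊥
      three {t} (R@(t∈ , t≢v , t≢p) , t≢q , zt , vt) vq =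
        em λ { (no ¬tq) → M.cut-off R ¬tq k ; (yes tq) →
        em λ { (no ¬tp) → M′.cut-off (t∈ , t≢v , t≢q) ¬tp k ; (yes tp) →
        M.triangle R t≢q zt vt vq tq tp } }
        where
        module M′ = Around (solve₂ m) S len (swap-pre pre) v∈ zv (symA S vq) M.v≢p

      absorb : ∀ {s₁ s₂} → s₁ ∈ L S v → s₂ ∈ L S v →
        (∀ (φ : Fin N → ℕ) → (∀ {x} → x ∈ l S → x ≢ v → φ x ∈ L S x) →
          ¬ ¬ (∃[ s ] ((s ≡ s₁ ⊎ s ≡ s₂) × (∀ {t} → t ∈ l S → A S (z S) t → A S v t → φ t ≢ s)))) → ⊥
      absorb {s₁} {s₂} s₁∈ s₂∈ pick = decide λ D →
        let module B = Absorb S v v∈ zv s₁ s₂ D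
            p∈′ = B.l′⁺ (p∈ pre) (≢-sym M.v≢p)
            q∈′ = B.l′⁺ (q∈ pre) (≢-sym v≢q)
        in solve₂ m B.S′ (ℕ.≤-pred (ℕ.≤-trans B.shrink len))
          (record { p∈ = p∈′ ; q∈ = q∈′ ; pq = B.A′⁺ p∈′ q∈′ (pq pre)
                  ; zp = B.A′z⁺ p∈′ (inj₁ (zp pre)) ; zq = B.A′z⁺ q∈′ (inj₁ (zq pre))
                  ; Lp = trans (B.L′-boundary (zp pre)) (Lp pre) ; Lq = trans (B.L′-boundary (zq pre)) (Lq pre)
                  ; c≢d = c≢d pre ; sizes = B.sizes′ {λ x → x ≡ p ⊎ x ≡ q} (sizes pre) })
          (λ col → B.unabsorb s₁∈ s₂∈ pick col k)

      |Lv| : 3 ≤ length (L S v)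
      |Lv| = proj₁ (sizes pre v∈ [ M.v≢p , v≢q ]′)

      module _ (φ : Fin N → ℕ) (inL : ∀ {x} → x ∈ l S → x ≢ v → φ x ∈ L S x) where
        φp : φ p ≡ c
        φp = ∈-singleton (Lp pre) (inL (p∈ pre) (≢-sym M.v≢p))
        φq : φ q ≡ d
        φq = ∈-singleton (Lq pre) (inL (q∈ pre) (≢-sym v≢q))

      -- Only `p` and `q` can be boundary neighbours of `v`, so a single colour other than `c` and
      -- `d` is reserved.
      absorb₀ : ¬ (∃[ t ] Inner t) → ⊥
      absorb₀ none = let s , s∈ , s∉ = another {S = S} (c ∷ d ∷ []) |Lv| in
        absorb s∈ s∈ λ φ inL k′ → k′ (s , inj₁ refl , pick s∉ φ inL)
        where
        pick : ∀ {s} → s ∉ c ∷ d ∷ [] → ∀ (φ : Fin N → ℕ) → (∀ {x} → x ∈ l S → x ≢ v → φ x ∈ L S x) →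
          ∀ {t} → t ∈ l S → A S (z S) t → A S v t → φ t ≢ s
        pick s∉ φ inL {t} t∈ zt vt with t ≟ p | t ≟ q
        ... | yes refl | _ = λ e → s∉ (here (trans (sym e) (φp φ inL)))
        ... | no _ | yes refl = λ e → s∉ (there (here (trans (sym e) (φq φ inL))))
        ... | no np | no nq = ⊥-elim (none (t , (t∈ , (λ { refl → irrA S vt }) , np) , nq , zt , vt))

      -- The boundary neighbours of `v` are `p` and `t`. Two colours other than `c` are reserved,
      -- and `t` uses at most one of them.
      one : ¬ (∃[ t₁ ] ∃[ t₂ ] (Inner t₁ × Inner t₂ × t₁ ≢ t₂)) → ∀ {t} → Inner t → ¬ A S v q → ⊥
      one ¬two {t} It ¬vq =
        let s₁ , s₁∈ , s₁∉ = another {S = S} (c ∷ []) (ℕ.≤-trans (s≤s (s≤s z≤n)) |Lv|)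
            s₂ , s₂∈ , s₂∉ = another {S = S} (c ∷ s₁ ∷ []) |Lv|
        in absorb s₁∈ s₂∈ λ φ inL k′ → k′ (choose s₁∉ s₂∉ φ inL)
        where
        pick : ∀ {s} → s ≢ c → ∀ (φ : Fin N → ℕ) → (∀ {x} → x ∈ l S → x ≢ v → φ x ∈ L S x) → φ t ≢ s →
          ∀ {t′} → t′ ∈ l S → A S (z S) t′ → A S v t′ → φ t′ ≢ s
        pick s≢c φ inL ≢s {t′} t∈ zt vt with t′ ≟ p | t′ ≟ q | t′ ≟ t
        ... | yes refl | _ | _ = λ e → s≢c (trans (sym e) (φp φ inL))
        ... | no _ | yes refl | _ = ⊥-elim (¬vq vt)
        ... | no _ | no _ | yes refl = ≢s
        ... | no np | no nq | no nt =
          ⊥-elim (¬two (t′ , t , ((t∈ , (λ { refl → irrA S vt }) , np) , nq , zt , vt) , It , nt))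
        choose : ∀ {s₁ s₂} → s₁ ∉ c ∷ [] → s₂ ∉ c ∷ s₁ ∷ [] → ∀ (φ : Fin N → ℕ) → (∀ {x} → x ∈ l S → x ≢ v → φ x ∈ L S x) →
          ∃[ s ] ((s ≡ s₁ ⊎ s ≡ s₂) × (∀ {t} → t ∈ l S → A S (z S) t → A S v t → φ t ≢ s))
        choose {s₁} {s₂} s₁∉ s₂∉ φ inL with φ t ℕ.≟ s₁
        ... | no ne = s₁ , inj₁ refl , pick (s₁∉ ∘ here) φ inL ne
        ... | yes e = s₂ , inj₂ refl , pick (s₂∉ ∘ here) φ inL (λ e′ → s₂∉ (there (here (trans (sym e′) e))))

-- End parts of a connected set.

module _ {A : Fin N → Fin N → Set} (symA : Symm A) {C : Fin N → Set} (cC : Conn A C) where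

  Minus : Fin N → Fin N → Set
  Minus d x = C x × x ≢ d

  -- For a component T of C − w avoiding g, take T of least size: a cut vertex inside T would give a smaller one.
  end-part : ∀ {g t₀} → C g → C t₀ → t₀ ≢ g →
    ¬ ¬ (∃[ w ] ∃[ t ] (C w × Minus w t × ¬ Path A (Minus w) t g ×
      (∀ {d} → Path A (Minus w) t d → Conn A (Minus d))))
  end-part {g} {t₀} Cg Ct₀ t₀≢g k = ¬¬-Π (λ d → decide₂ {P = Path A (Minus d)}) λ D →
    descend D _ (allFin N) ℕ.≤-refl Cg (Ct₀ , t₀≢g) (λ p → proj₂ (target p) refl) (λ {x} _ → ∈-allFin x)
    where
    descend : (∀ d x y → Dec (Path A (Minus d) x y)) → ∀ m l → length l ≤ m → ∀ {w t} → C w → Minus w t →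
      ¬ Path A (Minus w) t g → (∀ {x} → Path A (Minus w) t x → x ∈ l) → ⊥
    descend D zero l len Cw Mt _ cover = ≤0-nil len (cover (stop Mt))
    descend D (suc m) l len {w} {t} Cw Mt ¬g cover = k (w , t , Cw , Mt , ¬g , noncut)
      where
      -- If `y` is not joined to `w` off `d`, its component off `d` lies in `T` without `d`, and the
      -- descent goes on with `d` in the place of `w`.
      cut : ∀ {d y} → Path A (Minus w) t d → Minus d y → ¬ Path A (Minus d) y w → ⊥
      cut {d} {y} Td (Cy , y≢d) ¬yw =
        descend D m (remV d l) (ℕ.≤-pred (ℕ.≤-trans (remove-shrinks _≟_ (cover Td)) len))
          (proj₁ (target Td)) (Cy , y≢d) (¬g ∘ sub) (λ p → ∈-remove⁺ _≟_ (cover (sub p)) (proj₂ (target p)))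
        where
        -- If `y` were outside this component, a path from `y` to `w` would miss `d` and join `y` to
        -- `w` off `d`.
        Ty : Path A (Minus w) t y
        Ty with D w t y
        ... | yes p = p
        ... | no ¬p with cross (_≟ w) (cC Cy Cw) (λ { refl → ¬yw (stop (Cy , y≢d)) }) refl
        ... | a , _ , π , _ , refl , aw = ⊥-elim (¬yw (snoc
          (mapP (λ q → proj₁ (target q) , λ { refl → ¬p (Td ++P reverse symA q) }) (reach π))
          aw (Cw , λ { refl → proj₂ (target Td) refl })))
        sub : ∀ {x} → Path A (Minus d) y x → Path A (Minus w) t x
        sub p = Ty ++P mapP (λ q → proj₁ (target q) , λ { refl → ¬yw q }) (reach p)
      noncut : ∀ {d} → Path A (Minus w) t d → Conn A (Minus d)
      noncut {d} Td {x} {y} Mx My with D d x w | D d y w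
      ... | yes p | yes q = p ++P reverse symA q
      ... | no ¬p | _ = ⊥-elim (cut Td Mx ¬p)
      ... | yes _ | no ¬q = ⊥-elim (cut Td My ¬q)

-- Degrees, minors and greedy colouring.

module OnGraph (G : Graph) where

  open import Data.List.Membership.DecPropositional (_≟_ {n G}) using (_∈?_)

  V : Set
  V = Vertex G

  adj-symm : Symm (Adj G)
  adj-symm {x} {y} a = trans (adj-sym G y x) a

  adj-irr : Irr (Adj G)
  adj-irr {x} a with trans (sym a) (adj-irrefl G x)
  ... | ()

  Adj? : ∀ x y → Dec (Adj G x y)
  Adj? x y = adj G x y Bool.≟ true

  nbrs : V → List V
  nbrs v = filterᵇ (adj G v) (allFin (n G))

  nbrs⁺ : ∀ {v w} → Adj G v w → w ∈ nbrs v
  nbrs⁺ {v} {w} a = ∈-filter⁺ (Bool.T? ∘ adj G v) (∈-allFin w) (subst Bool.T (sym a) tt)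

  nbrs⁻ : ∀ {v w} → w ∈ nbrs v → Adj G v w
  nbrs⁻ {v} {w} w∈ with adj G v w | proj₂ (∈-filter⁻ (Bool.T? ∘ adj G v) {xs = allFin (n G)} w∈)
  ... | true | _ = refl

  nbrs-unique : ∀ v → Unique (nbrs v)
  nbrs-unique v = Unique.filter⁺ (Bool.T? ∘ adj G v) (Unique.allFin⁺ (n G))

  deg-≥ : ∀ {v xs} → Unique xs → (∀ {x} → x ∈ xs → Adj G v x) → length xs ≤ deg G v
  deg-≥ u h = ⊆-length _≟_ u (nbrs⁺ ∘ h)

  deg-≤ : ∀ {v} xs → (∀ {x} → Adj G v x → x ∈ xs) → deg G v ≤ length xs
  deg-≤ {v} xs h = ⊆-length _≟_ (nbrs-unique v) (h ∘ nbrs⁻)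

  toPath : ∀ {P x y ℓ} → WalkIn G P x y ℓ → Path (Adj G) P x y
  toPath (here p) = stop p
  toPath (step p a w) = go p a (toPath w)

  toWalk : ∀ {P x y} → Path (Adj G) P x y → ConnectedIn G P x y
  toWalk (stop p) = _ , here p
  toWalk (go p a w) = _ , step p a (proj₂ (toWalk w))

  -- The conclusion is negative, so membership in the branch sets may be taken as decided and turned
  -- into Boolean values.
  minor-free : ¬ HasMinor G (K 5) → K5Free (Adj G)
  minor-free none k = decide₂ {P = K5.B k} λ B? → none (minor B?)
    where
    minor : (∀ i x → Dec (K5.B k i x)) → HasMinor G (K 5)
    minor B? = B , inhabited
      , (λ i x y bx by → toWalk (mapP (λ b → dec-true (B? _ _) b) (K5.conn k i (from bx) (from by))))
      , (λ i j x ne bx → dec-false (B? j x) (K5.disj k i j ne (from bx)))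
      , λ i j a → let x , y , bx , by , e = K5.touch k i j (λ { refl → irr i a }) in
          x , y , dec-true (B? i x) bx , dec-true (B? j y) by , e
      where
      B : Fin 5 → V → Bool
      B i x = does (B? i x)
      from : ∀ {i x} → B i x ≡ true → K5.B k i x
      from {i} {x} e with B? i x
      ... | yes b = b
      irr : ∀ i → ¬ Adj (K 5) i i
      irr i a with trans (sym a) (Kadj-irrefl i)
      ... | ()
      other : ∀ (i : Fin 5) → ∃[ j ] i ≢ j
      other zero = suc zero , λ ()
      other (suc i) = zero , λ ()
      inhabited : ∀ i → ∃[ v ] B i v ≡ true
      inhabited i = let j , ne = other i ; x , _ , bx , _ = K5.touch k i j ne in x , dec-true (B? i x) bx

  put : (V → ℕ) → V → ℕ → V → ℕ
  put φ u c x with x ≟ u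
  ... | yes _ = c
  ... | no _ = φ x

  put-≡ : ∀ φ u c → put φ u c u ≡ c
  put-≡ φ u c with u ≟ u
  ... | yes _ = refl
  ... | no ne = ⊥-elim (ne refl)

  put-≢ : ∀ φ u c {x} → x ≢ u → put φ u c x ≡ φ x
  put-≢ φ u c {x} ne with x ≟ u
  ... | yes e = ⊥-elim (ne e)
  ... | no _ = refl

  module Lists (L : V → List ℕ) (uniq : ∀ x → Unique (L x)) where

    Fits : (V → ℕ) → V → Set
    Fits ψ w = ψ w ∈ L w × (∀ {y} → Adj G w y → ψ w ≢ ψ y)

    -- The colour of `k` is disregarded, so fewer colours are excluded than `w` has neighbours.
    spare : ∀ ψ {w k} → Adj G w k → deg G w ≤ length (L w) →
      ∃[ c ] (c ∈ L w × (∀ {y} → Adj G w y → y ≢ k → ψ y ≢ c))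
    spare ψ {w} {k} a len with ∃-∉ ℕ._≟_ (uniq w) (map ψ (remV k (nbrs w)))
      (ℕ.<-≤-trans (ℕ.≤-<-trans (ℕ.≤-reflexive (length-map ψ (remV k (nbrs w)))) (remove-shrinks _≟_ (nbrs⁺ a))) len)
    ... | c , c∈ , c∉ = c , c∈ , λ { a′ ne refl → c∉ (∈-map⁺ ψ (∈-remove⁺ _≟_ (nbrs⁺ a′) ne)) }

    -- Colour D towards u, so that every vertex other than u still has an uncoloured neighbour when its turn comes.
    greedy : ∀ {D : V → Set} {u} → D u → (∀ {x} → D x → Path (Adj G) D x u) →
      (∀ {x} → D x → deg G x ≤ length (L x)) → ∀ φ →
      (∀ ψ → (∀ {y} → ¬ D y → ψ y ≡ φ y) → ¬ ¬ (∃[ c ] (c ∈ L u × (∀ {y} → Adj G u y → ψ y ≢ c)))) →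
      ¬ ¬ (∃[ ψ ] ((∀ {y} → ¬ D y → ψ y ≡ φ y) × (∀ {w} → D w → Fits ψ w)))
    greedy {D} {u} Du toRoot big φ root k =
      grow _ (allFin (n G)) ℕ.≤-refl (u ∷ []) (λ {x} _ _ → ∈-allFin x) (λ { (here refl) → Du }) (here refl) ext-root
      where
      -- The vertices of `us` can be recoloured whatever the colours on the rest of `D`, so a vertex
      -- added later is coloured earlier.
      Ext : List V → Set
      Ext us = ∀ ψ → (∀ {y} → ¬ D y → ψ y ≡ φ y) →
        ¬ ¬ (∃[ χ ] ((∀ {y} → y ∉ us → χ y ≡ ψ y) × (∀ {w} → w ∈ us → Fits χ w)))
      ext-root : Ext (u ∷ [])
      ext-root ψ off k′ = root ψ off λ (c , c∈ , free) → k′ (put ψ u c , (λ y∉ → put-≢ ψ u c (y∉ ∘ here)) ,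
        λ { (here refl) → subst (_∈ L u) (sym (put-≡ ψ u c)) c∈ , λ a e → free a
              (sym (trans (sym (put-≡ ψ u c)) (trans e (put-≢ ψ u c (λ { refl → adj-irr a }))))) })
      -- `w` is coloured while its neighbour `v` is still to be recoloured, so `spare` applies;
      -- afterwards the vertices of `us` avoid the colour of `w`.
      ext-step : ∀ {w v us} → D w → w ∉ us → v ∈ us → Adj G w v → (∀ {x} → x ∈ us → D x) → Ext us → Ext (w ∷ us)
      ext-step {w} {v} {us} Dw w∉ v∈ wv us⊆ ext ψ off k′ =
        let c , c∈ , free = spare ψ wv (big Dw) in
        ext (put ψ w c) (λ ¬Dy → trans (put-≢ ψ w c (λ { refl → ¬Dy Dw })) (off ¬Dy)) λ (χ , same , fits) →
        let χw = trans (same w∉) (put-≡ ψ w c) in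
        k′ (χ , (λ y∉ → trans (same (y∉ ∘ there)) (put-≢ ψ w c (y∉ ∘ here))) , λ
          { (there x∈) → fits x∈
          ; (here refl) → subst (_∈ L w) (sym χw) c∈ , λ {y} a e → clash c χ same fits χw free y a e })
        where
        clash : ∀ c χ → (∀ {y} → y ∉ us → χ y ≡ put ψ w c y) → (∀ {w} → w ∈ us → Fits χ w) → χ w ≡ c →
          (∀ {y} → Adj G w y → y ≢ v → ψ y ≢ c) → ∀ y → Adj G w y → χ w ≢ χ y
        clash c χ same fits χw free y a e with y ∈? us
        ... | yes y∈ = proj₂ (fits y∈) (adj-symm a) (sym e)
        ... | no y∉ = free a (λ { refl → y∉ v∈ })
          (sym (trans (sym χw) (trans e (trans (same y∉) (put-≢ ψ w c (λ { refl → adj-irr a }))))))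
      grow : ∀ m l → length l ≤ m → ∀ us → (∀ {x} → D x → x ∉ us → x ∈ l) → (∀ {x} → x ∈ us → D x) →
        u ∈ us → Ext us → ⊥
      grow m l len us cover us⊆ u∈ ext = by-cases (∃[ w ] ∃[ v ] (D w × w ∉ us × v ∈ us × Adj G w v))
        (λ (w , v , Dw , w∉ , v∈ , wv) → more m len Dw w∉ v∈ wv)
        (λ none → ext φ (λ _ → refl) λ (χ , same , fits) →
          k (χ , (λ ¬Dy → same (¬Dy ∘ us⊆)) , λ Dw → fits (full none Dw)))
        where
        full : ¬ (∃[ w ] ∃[ v ] (D w × w ∉ us × v ∈ us × Adj G w v)) → ∀ {x} → D x → x ∈ us
        full none {x} Dx with x ∈? us
        ... | yes x∈ = x∈
        ... | no x∉ with cross (_∈? us) (toRoot Dx) x∉ u∈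
        ... | a , b , π , _ , b∈ , ab = ⊥-elim (none (a , b , proj₁ (target π) , proj₂ (target π) , b∈ , ab))
        more : ∀ m → length l ≤ m → ∀ {w v} → D w → w ∉ us → v ∈ us → Adj G w v → ⊥
        more zero len Dw w∉ _ _ = ≤0-nil len (cover Dw w∉)
        more (suc m) len {w} Dw w∉ v∈ wv =
          grow m (remV w l) (ℕ.≤-pred (ℕ.≤-trans (remove-shrinks _≟_ (cover Dw w∉)) len)) (w ∷ us)
            (λ Dx x∉ → ∈-remove⁺ _≟_ (cover Dx (x∉ ∘ there)) (x∉ ∘ here))
            (λ { (here refl) → Dw ; (there x∈) → us⊆ x∈ }) (there u∈) (ext-step Dw w∉ v∈ wv us⊆ ext)

-- Adjacent twins in a 3-connected graph.

module ThreeConnected (G : Graph) (free : K5Free (Adj G)) (three : KConnected 3 G) where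

  open OnGraph G
  open import Data.List.Membership.DecPropositional (_≟_ {n G}) using (_∈?_)

  avoid : ∀ a b {x y} → x ≢ a → x ≢ b → y ≢ a → y ≢ b → Path (Adj G) (λ w → w ≢ a × w ≢ b) x y
  avoid a b {x} {y} xa xb ya yb =
    mapP (λ ∉ → (∉ ∘ here) , (∉ ∘ there ∘ here))
      (toPath (proj₂ (proj₂ three (a ∷ b ∷ []) (s≤s (s≤s (s≤s z≤n))) x y (notin xa xb) (notin ya yb))))
    where
    notin : ∀ {w} → w ≢ a → w ≢ b → w ∉ a ∷ b ∷ []
    notin wa wb (here e) = wa e
    notin wa wb (there (here e)) = wb e

  -- Without `t` and `a` the graph is still connected. An end part `D` of it that avoids `g`
  -- contains two neighbours of `t`, hence of `a`; a path between them inside `D` yields a K₅ model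
  -- or a cut vertex in `D`. If `D` is a single vertex, its degree is at most three.
  true-twins : ∀ {t a} → Adj G t a →
    (∀ {x} → x ≢ t → x ≢ a → Adj G t x → Adj G a x) → (∀ {x} → x ≢ t → x ≢ a → Adj G a x → Adj G t x) →
    (∀ {x} → x ≢ t → x ≢ a → Adj G t x → 4 ≤ deg G x) →
    ∀ {g h} → g ≢ h → h ≢ t → h ≢ a → g ≢ t → g ≢ a → Adj G t g → ⊥
  true-twins {t} {a} ta t→a a→t big {g} {h} g≢h h≢t h≢a g≢t g≢a tg =
    end-part adj-symm cH (g≢t , g≢a) (h≢t , h≢a) (≢-sym g≢h) λ (r , e , Hr , He , ¬Dg , noncut) →
      main Hr He ¬Dg noncut
    where
    H : V → Set
    H x = x ≢ t × x ≢ a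
    cH : Conn (Adj G) H
    cH (xt , xa) (yt , ya) = avoid t a xt xa yt ya
    t≢a : t ≢ a
    t≢a refl = adj-irr ta
    H- : V → V → Set
    H- d x = H x × x ≢ d
    ta? : ∀ x → Dec (x ≡ t ⊎ x ≡ a)
    ta? x with x ≟ t | x ≟ a
    ... | yes e | _ = yes (inj₁ e)
    ... | no _ | yes e = yes (inj₂ e)
    ... | no nt | no na = no [ nt , na ]′
    module _ {r e : V} (Hr : H r) (He : H- r e) (¬Dg : ¬ Path (Adj G) (H- r) e g)
      (noncut : ∀ {d} → Path (Adj G) (H- r) e d → Conn (Adj G) (H- d)) where
      D : V → Set
      D = Path (Adj G) (H- r) e
      -- By 3-connectivity `e′` is joined to `t` off `r` and `b`. Until it meets `t` or `a` the path
      -- stays in `D`, and its last vertex there sees `t` because neighbours of `a` are neighbours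
      -- of `t`.
      escape : ∀ {e′} b → D e′ → e′ ≢ b → H b → ∃[ d ] (D d × Adj G t d × d ≢ b)
      escape b De′ e′≢b Hb with cross ta? (avoid r b (proj₂ (target De′)) e′≢b (≢-sym (proj₁ Hr)) (≢-sym (proj₁ Hb)))
        [ proj₁ (proj₁ (target De′)) , proj₂ (proj₁ (target De′)) ]′ (inj₁ refl)
      ... | d , _ , π , _ , ta , ad = d
        , De′ ++P mapP (λ ((≢r , _) , ¬ta) → (¬ta ∘ inj₁ , ¬ta ∘ inj₂) , ≢r) π
        , [ (λ { refl → adj-symm ad }) , (λ { refl → a→t (¬ta ∘ inj₁) (¬ta ∘ inj₂) (adj-symm ad) }) ]′ ta
        , proj₂ (proj₁ (target π))
        where ¬ta = proj₂ (target π)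
      linked : ∀ {b₁ b₂} → D b₁ → D b₂ → b₁ ≢ b₂ → Adj G t b₁ → Adj G t b₂ → ⊥
      linked {b₁} {b₂} D₁ D₂ b₁≢b₂ tb₁ tb₂ = decide λ T? → [ found , unfound ]′ (split adj-symm T? sp)
        where
        π = comp-conn adj-symm D₁ D₂
        vs : List V
        vs = proj₁ (simple π)
        sp : SPath (Adj G) b₁ b₂ vs
        sp = proj₁ (proj₂ (simple π))
        vs⊆ : ∀ {x} → x ∈ vs → D x
        vs⊆ = proj₂ (proj₂ (simple π))
        Z T : V → Set
        Z = Path (Adj G) (λ x → H x × x ∉ vs) r
        T y = ∃[ x ] (Z x × Adj G x y)
        Zr : Z r
        Zr = stop (Hr , λ r∈ → proj₂ (target (vs⊆ r∈)) refl)
        -- Up to `r` the path from `g` avoids `D`, and so `vs`: entering `D` would join `g` to `D`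
        -- off `r`.
        Zg : Z g
        Zg with g ≟ r
        ... | yes refl = Zr
        ... | no g≢r with cross (_≟ r) (cH (g≢t , g≢a) Hr) g≢r refl
        ... | b , _ , ρ , _ , refl , br = go (source Zr) (adj-symm br) (reverse adj-symm
          (mapP (λ q → proj₁ (target q) , λ y∈ → ¬Dg (vs⊆ y∈ ++P reverse adj-symm q)) (reach ρ)))
        ∉vs : ∀ {x} → ¬ H x → x ∉ vs
        ∉vs ¬H x∈ = ¬H (proj₁ (target (vs⊆ x∈)))
        found : Split {A = Adj G} b₁ b₂ vs T → ⊥
        found σ = free (rooted-K5 adj-symm t≢a ta (comp-conn adj-symm) (λ w → proj₂ (target w))
          (λ w → proj₁ (proj₁ (target w)) refl) (λ w → proj₂ (proj₁ (target w)) refl)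
          (∉vs λ (n , _) → n refl) (∉vs λ (_ , n) → n refl) Zg tg (t→a g≢t g≢a tg)
          tb₁ (toa D₁ tb₁) tb₂ (toa D₂ tb₂) σ)
          where
          toa : ∀ {b} → D b → Adj G t b → Adj G a b
          toa Db tb = let (bt , ba) , _ = target Db in t→a bt ba tb
        -- All edges from `Z` to the path end at `s`, so deleting `s` would separate `r` from an end
        -- of the path, although `s` lies in `D`.
        unfound : ∃[ s ] (s ∈ vs × ∀ {x} → x ∈ vs → T x → x ≡ s) → ⊥
        unfound (s , s∈ , only) with b₁ ≟ s
        ... | no ne = blocked b₁ (first∈ sp) ne
          where
          blocked : ∀ b → b ∈ vs → b ≢ s → ⊥
          blocked b b∈ b≢s with cross (_∈? vs) (noncut (vs⊆ s∈) (Hr , λ { refl → proj₂ (source Zr) s∈ })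
            (proj₁ (target (vs⊆ b∈)) , b≢s)) (proj₂ (source Zr)) b∈
          ... | x , y , ρ , (_ , y≢s) , y∈ , xy = y≢s (only y∈ (x , mapP (λ ((h , _) , ∉) → h , ∉) ρ , xy))
        ... | yes refl with cross (_∈? vs) (noncut (vs⊆ s∈) (Hr , λ { refl → proj₂ (source Zr) s∈ })
            (proj₁ (target D₂) , ≢-sym b₁≢b₂)) (proj₂ (source Zr)) (last∈ sp)
        ... | x , y , ρ , (_ , y≢s) , y∈ , xy = y≢s (only y∈ (x , mapP (λ ((h , _) , ∉) → h , ∉) ρ , xy))
      main : ⊥
      main with escape r (stop He) (proj₂ He) Hr
      ... | b₁ , D₁ , tb₁ , _ = by-cases (∃[ d ] (D d × d ≢ b₁))
        (λ (d , Dd , d≢b₁) → let b₂ , D₂ , tb₂ , b₂≢b₁ = escape b₁ Dd d≢b₁ (proj₁ (target D₁)) in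
          linked D₁ D₂ (≢-sym b₂≢b₁) tb₁ tb₂)
        -- Here `D` is the single vertex `b₁`, whose neighbours are among `r`, `t` and `a`.
        (λ none → ℕ.<⇒≱ (big (proj₁ (proj₁ (target D₁))) (proj₂ (proj₁ (target D₁))) tb₁)
          (deg-≤ (r ∷ t ∷ a ∷ []) (near none)))
        where
        near : ¬ (∃[ d ] (D d × d ≢ b₁)) → ∀ {x} → Adj G b₁ x → x ∈ r ∷ t ∷ a ∷ []
        near none {x} b₁x with x ≟ r | x ≟ t | x ≟ a
        ... | yes e | _ | _ = here e
        ... | no _ | yes e | _ = there (here e)
        ... | no _ | no _ | yes e = there (there (here e))
        ... | no nr | no nt | no na =
          ⊥-elim (none (x , snoc D₁ b₁x ((nt , na) , nr) , λ { refl → adj-irr b₁x }))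

  -- Extending a colouring to one component of small degree.

  -- What the colouring of the vertices of large degree must satisfy so that it extends to the component C.
  record Plan (L : V → List ℕ) (uniq : ∀ x → Unique (L x)) (C : V → Set) : Set where
    open Lists L uniq
    field
      x₀ : V
      x₀∉ : ¬ C x₀
      x₀-touches : ∃[ c ] (C c × Adj G c x₀)
      α β : ℕ
      extend : ∀ (φ : V → ℕ) →
        (∀ {c y} → C c → Adj G c y → ¬ C y → φ y ≢ α × φ y ≢ β) →
        -- This will hold because contracting `C` to `x₀` makes `x₀` adjacent to every other vertex
        -- around `C`.
        (∀ {c y} → C c → Adj G c y → ¬ C y → y ≢ x₀ → φ y ≢ φ x₀) →
        ¬ ¬ (∃[ ψ ] ((∀ {y} → ¬ C y → ψ y ≡ φ y) × (∀ {w} → C w → Fits ψ w)))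

  module Component (k : ℕ) (7≤k : 7 ≤ k) (L : V → List ℕ) (uniq : ∀ x → Unique (L x))
    (len : ∀ x → length (L x) ≡ deg G x ⊓ k) (C : V → Set) (C? : ∀ x → Dec (C x)) (cC : Conn (Adj G) C)
    (low : ∀ {x} → C x → deg G x < k) (closed : ∀ {x y} → C x → Adj G x y → deg G y < k → C y)
    {s : V} (Cs : C s) {s′ : V} (¬Cs′ : ¬ C s′) (low′ : deg G s′ < k) where

    open Lists L uniq

    |L| : ∀ {x} → C x → length (L x) ≡ deg G x
    |L| {x} Cx = trans (len x) (ℕ.m≤n⇒m⊓n≡m (ℕ.<⇒≤ (low Cx)))

    s′-far : ∀ {x} → C x → ¬ Adj G x s′
    s′-far Cx a = ¬Cs′ (closed Cx a low′)

    joined : ∀ x y → Path (Adj G) (λ _ → ⊤) x y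
    joined x y = mapP (λ _ → tt) (toPath (proj₂ (proj₂ three [] (s≤s z≤n) x y (λ ()) (λ ()))))

    boundary : ∃[ x ] (¬ C x × ∃[ c ] (C c × Adj G c x))
    boundary with cross C? (joined s′ s) ¬Cs′ Cs
    ... | x , c , π , _ , Cc , xc = x , proj₂ (target π) , c , Cc , adj-symm xc

    -- `u` is joined to its non-neighbour `s′`, also after deletion of a first neighbour `y₁`, which
    -- is passed to `avoid` twice. The second path starts with another neighbour.
    2≤deg : ∀ {u} → C u → 2 ≤ deg G u
    2≤deg {u} Cu with joined u s′
    ... | stop _ = ⊥-elim (¬Cs′ Cu)
    ... | go {y = y₁} _ uy₁ _ with avoid y₁ y₁ {u} {s′} (≢-nbr uy₁) (≢-nbr uy₁) (s′≢ uy₁) (s′≢ uy₁)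
      where
      ≢-nbr : ∀ {x y} → Adj G x y → x ≢ y
      ≢-nbr a refl = adj-irr a
      s′≢ : ∀ {y} → Adj G u y → s′ ≢ y
      s′≢ a refl = s′-far Cu a
    ... | stop _ = ⊥-elim (¬Cs′ Cu)
    ... | go _ uy₂ π = deg-≥ {xs = y₁ ∷ _ ∷ []} ((≢-sym (proj₁ (source π)) ∷ []) ∷ [] ∷ [])
      λ { (here refl) → uy₁ ; (there (here refl)) → uy₂ }

    two-colours : ∀ {u} → C u → ∃[ α ] ∃[ β ] (α ∈ L u × β ∈ L u × β ≢ α)
    two-colours {u} Cu =
      let 2≤ = subst (2 ≤_) (sym (|L| Cu)) (2≤deg Cu)
          α , α∈ , _ = ∃-∉ ℕ._≟_ (uniq u) [] (ℕ.<-≤-trans (s≤s z≤n) 2≤)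
          β , β∈ , β∉ = ∃-∉ ℕ._≟_ (uniq u) (α ∷ []) 2≤
      in α , β , α∈ , β∈ , β∉ ∘ here

    big : ∀ {x} → C x → deg G x ≤ length (L x)
    big Cx = ℕ.≤-reflexive (sym (|L| Cx))

    C- : V → V → Set
    C- d x = C x × x ≢ d

    -- `a` receives `α` beforehand, and the rest of `C`, still connected, is coloured greedily
    -- towards `u`.
    greedy-after : ∀ {a u α} → C a → Conn (Adj G) (C- a) → C- a u → α ∈ L a → ∀ (φ : V → ℕ) →
      (∀ {y} → Adj G a y → ¬ C y → φ y ≢ α) →
      (∀ (ψ : V → ℕ) → ψ a ≡ α → (∀ {y} → ¬ C y → ψ y ≡ φ y) →
        ∃[ c ] (c ∈ L u × (∀ {y} → Adj G u y → ψ y ≢ c))) →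
      ¬ ¬ (∃[ ψ ] ((∀ {y} → ¬ C y → ψ y ≡ φ y) × (∀ {w} → C w → Fits ψ w)))
    greedy-after {a} {u} {α} Ca cCa Mu α∈ φ ok root none =
      greedy {C- a} Mu (λ Mx → cCa Mx Mu) (big ∘ proj₁) φ′
        (λ ψ off k′ → k′ (root ψ (trans (off (λ (_ , ne) → ne refl)) (put-≡ φ a α)) (off′ off)))
        λ (ψ , off , fits) → let ψa = trans (off (λ (_ , ne) → ne refl)) (put-≡ φ a α) in
          none (ψ , off′ off , λ Cw → fits-all ψ ψa (off′ off) fits Cw)
      where
      φ′ = put φ a α
      off′ : ∀ {ψ : V → ℕ} → (∀ {y} → ¬ C- a y → ψ y ≡ φ′ y) → ∀ {y} → ¬ C y → ψ y ≡ φ y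
      off′ off ¬Cy = trans (off (¬Cy ∘ proj₁)) (put-≢ φ a α (λ { refl → ¬Cy Ca }))
      fits-all : ∀ (ψ : V → ℕ) → ψ a ≡ α → (∀ {y} → ¬ C y → ψ y ≡ φ y) → (∀ {w} → C- a w → Fits ψ w) →
        ∀ {w} → C w → Fits ψ w
      fits-all ψ ψa off fits {w} Cw with w ≟ a
      ... | no ne = fits (Cw , ne)
      ... | yes refl = subst (_∈ L w) (sym ψa) α∈ , proper
        where
        proper : ∀ {y} → Adj G w y → ψ w ≢ ψ y
        proper {y} wy e with C? y
        ... | yes Cy = proj₂ (fits (Cy , λ { refl → adj-irr wy })) (adj-symm wy) (sym e)
        ... | no ¬Cy = ok wy ¬Cy (trans (sym (off ¬Cy)) (trans (sym e) ψa))

    -- The colour of `y` is not among those that the other neighbours leave to `u`, so `y` excludes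
    -- nothing further.
    spare′ : ∀ (ψ : V → ℕ) {u y β} → C u → Adj G u y → (∀ {c} → c ∈ L u → (∀ {y′} → Adj G u y′ → y′ ≢ y → ψ y′ ≢ c) → c ≢ β) →
      ψ y ≡ β → ∃[ c ] (c ∈ L u × (∀ {y′} → Adj G u y′ → ψ y′ ≢ c))
    spare′ ψ {u} {y} Cu uy ≢β ψy with spare ψ uy (big Cu)
    ... | c , c∈ , free′ = c , c∈ , avoids
      where
      avoids : ∀ {y′} → Adj G u y′ → ψ y′ ≢ c
      avoids {y′} uy′ with y′ ≟ y
      ... | no ne = free′ uy′ ne
      ... | yes refl = λ e → ≢β c∈ free′ (trans (sym e) ψy)

    module _ (no-plan : ¬ Plan L uniq C) where

      -- With at most one neighbour in `C`, `u` could be coloured last: of two colours forbidden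
      -- around `C`, that neighbour takes at most one.
      two-inner : ∀ {u} → C u →
        ¬ ¬ (∃[ y₁ ] ∃[ y₂ ] (C y₁ × C y₂ × Adj G u y₁ × Adj G u y₂ × y₁ ≢ y₂))
      two-inner {u} Cu none = let x , ¬Cx , x-touches = boundary
                                  α , β , α∈ , β∈ , β≢α = two-colours Cu
                              in no-plan record
        { x₀ = x ; x₀∉ = ¬Cx ; x₀-touches = x-touches ; α = α ; β = β
        ; extend = λ φ forb _ → greedy {C} Cu (λ Cx → cC Cx Cu) big φ (root α∈ β∈ β≢α φ forb) }
        where
        root : ∀ {α β} → α ∈ L u → β ∈ L u → β ≢ α → ∀ (φ : V → ℕ) →
          (∀ {c y} → C c → Adj G c y → ¬ C y → φ y ≢ α × φ y ≢ β) →
          ∀ (ψ : V → ℕ) → (∀ {y} → ¬ C y → ψ y ≡ φ y) → ¬ ¬ (∃[ c ] (c ∈ L u × (∀ {y} → Adj G u y → ψ y ≢ c)))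
        root {α} {β} α∈ β∈ β≢α φ forb ψ off k′ = by-cases (∃[ t ] (C t × Adj G u t × ψ t ≡ α))
          (λ (t , Ct , ut , ψt) → k′ (β , β∈ , at-β Ct ut ψt))
          (λ free-α → k′ (α , α∈ , at-α free-α))
          where
          at-α : ¬ (∃[ t ] (C t × Adj G u t × ψ t ≡ α)) → ∀ {y} → Adj G u y → ψ y ≢ α
          at-α free-α {y} uy e with C? y
          ... | yes Cy = free-α (y , Cy , uy , e)
          ... | no ¬Cy = proj₁ (forb Cu uy ¬Cy) (trans (sym (off ¬Cy)) e)
          at-β : ∀ {t} → C t → Adj G u t → ψ t ≡ α → ∀ {y} → Adj G u y → ψ y ≢ β
          at-β {t} Ct ut ψt {y} uy e with C? y
          ... | no ¬Cy = proj₂ (forb Cu uy ¬Cy) (trans (sym (off ¬Cy)) e)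
          ... | yes Cy with t ≟ y
          ... | yes refl = β≢α (trans (sym e) ψt)
          ... | no ne = none (t , y , Ct , Cy , ut , uy , ne)

      -- A colour of `u` missing from the list of `v` could be forbidden around `C` and given to
      -- `u`; then `u` would exclude nothing at `v`.
      lists-grow : ∀ {u v} → C u → C v → Adj G u v → Conn (Adj G) (C- u) → ∀ {α} → α ∈ L u → α ∈ L v
      lists-grow {u} {v} Cu Cv uv cCu {α} α∈ with any? (α ℕ.≟_) (L v)
      ... | yes α∈v = α∈v
      ... | no α∉v = let x , ¬Cx , x-touches = boundary in ⊥-elim (no-plan record
        { x₀ = x ; x₀∉ = ¬Cx ; x₀-touches = x-touches ; α = α ; β = α
        ; extend = λ φ forb _ → greedy-after Cu cCu (Cv , λ { refl → adj-irr uv }) α∈ φ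
            (λ uy ¬Cy → proj₁ (forb Cu uy ¬Cy))
            (λ ψ ψu off → spare′ ψ Cv (adj-symm uv) (λ c∈ _ → λ { refl → α∉v c∈ }) ψu) })

      -- Otherwise `C` could be contracted to `x` itself, so that no other vertex around `C` has the
      -- colour of `x`.
      same-outside : ∀ {u v} → C u → C v → Adj G u v → Conn (Adj G) (C- u) → Conn (Adj G) (C- v) →
        ∀ {x} → ¬ C x → Adj G u x → Adj G v x
      same-outside {u} {v} Cu Cv uv cCu cCv {x} ¬Cx ux with Adj? v x
      ... | yes vx = vx
      ... | no ¬vx = ⊥-elim (no-plan record
        -- The extension rests on the colour of `x`, so the values of `α` and `β` are arbitrary.
        { x₀ = x ; x₀∉ = ¬Cx ; x₀-touches = u , Cu , ux ; α = 0 ; β = 0 ; extend = λ φ _ → ext φ })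
        where
        -- φ x occurs nowhere else around C: either u has no use for it, or v can take it and u sees it twice.
        ext : ∀ (φ : V → ℕ) → (∀ {c y} → C c → Adj G c y → ¬ C y → y ≢ x → φ y ≢ φ x) →
          ¬ ¬ (∃[ ψ ] ((∀ {y} → ¬ C y → ψ y ≡ φ y) × (∀ {w} → C w → Fits ψ w)))
        ext φ only with any? (φ x ℕ.≟_) (L u)
        ... | no ∉u = greedy {C} Cu (λ Cy → cC Cy Cu) big φ
          (λ ψ off k′ → k′ (spare′ ψ Cu ux (λ c∈ _ → λ { refl → ∉u c∈ }) (off ¬Cx)))
        ... | yes ∈u = greedy-after Cv cCv (Cu , λ { refl → adj-irr uv }) (lists-grow Cu Cv uv cCu ∈u) φ
          (λ vy ¬Cy → only Cv vy ¬Cy (λ { refl → ¬vx vy }))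
          (λ ψ ψv off → spare′ ψ Cu ux
            (λ c∈ free′ → λ { refl → free′ uv (λ { refl → ¬Cx Cv }) ψv }) (off ¬Cx))

      module EndPart {w t : V} (Cw : C w) (Mt : C- w t)
        (noncut : ∀ {d} → Path (Adj G) (C- w) t d → Conn (Adj G) (C- d)) (T? : ∀ x → Dec (Path (Adj G) (C- w) t x)) where

        T : V → Set
        T = Path (Adj G) (C- w) t

        Tt : T t
        Tt = stop Mt

        T⊆C : ∀ {x} → T x → C x
        T⊆C p = proj₁ (target p)

        T≢w : ∀ {x} → T x → x ≢ w
        T≢w p = proj₂ (target p)

        along : ∀ {d e x} → Path (Adj G) T d e → ¬ C x → Adj G d x → Adj G e x
        along (stop _) ¬Cx dx = dx
        along (go Td dd′ π) ¬Cx dx = along π ¬Cx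
          (same-outside (T⊆C Td) (T⊆C (source π)) dd′ (noncut Td) (noncut (source π)) ¬Cx dx)

        t→ : ∀ {d x} → T d → ¬ C x → Adj G t x → Adj G d x
        t→ Td = along (reach Td)

        →t : ∀ {d x} → T d → ¬ C x → Adj G d x → Adj G t x
        →t Td = along (reverse adj-symm (reach Td))

        Far : V → V → Set
        Far b y = (y ≢ w × y ≢ b) × ¬ T y

        -- A path from `s′` to `t` off `w` and `b` enters `T` from a vertex outside `C`, since `w`
        -- is the only vertex of `C` outside `T` that can have neighbours in `T`.
        outside : ∀ b → b ≢ s′ → ¬ T b → ∃[ x ] (¬ C x × Adj G t x × Path (Adj G) (Far b) s′ x)
        outside b b≢s′ ¬Tb with cross T? (avoid w b (λ { refl → ¬Cs′ Cw }) (≢-sym b≢s′) (T≢w Tt) (λ { refl → ¬Tb Tt }))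
                                   (¬Cs′ ∘ T⊆C) Tt
        ... | x , d , π , _ , Td , xd = x , ¬Cx , →t Td ¬Cx (adj-symm xd) , π
          where
          ¬Cx : ¬ C x
          ¬Cx Cx = proj₂ (target π) (snoc Td (adj-symm xd) (Cx , proj₁ (proj₁ (target π))))

        module Ends {x₁ x₂ : V} (¬Cx₁ : ¬ C x₁) (¬Cx₂ : ¬ C x₂) (tx₁ : Adj G t x₁) (tx₂ : Adj G t x₂)
          (x₂≢x₁ : x₂ ≢ x₁) (x₂x₁ : Path (Adj G) (Far w) x₂ x₁) where

          W- : V → V → Set
          W- d x = (T x ⊎ x ≡ w) × x ≢ d

          -- Since `d` does not cut `C`, `x` is joined to `w` off `d`; before `w` the path cannot
          -- leave `T`.
          toward-w : ∀ {d x} → T d → T x → x ≢ d → ∃[ e ] (Path (Adj G) (λ y → T y × y ≢ d) x e × Adj G e w)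
          toward-w Td Tx x≢d with cross (_≟ w) (noncut Td (T⊆C Tx , x≢d) (Cw , ≢-sym (T≢w Td))) (T≢w Tx) refl
          ... | e , _ , π , _ , refl , ew = e
            , mapP (λ q → Tx ++P mapP (λ ((c , _) , nw) → c , nw) q , proj₂ (proj₁ (target q))) (reach π) , ew

          W-conn : ∀ {d} → T d → Conn (Adj G) (W- d)
          W-conn {d} Td x y = to-w x ++P reverse adj-symm (to-w y)
            where
            to-w : ∀ {x} → W- d x → Path (Adj G) (W- d) x w
            to-w (inj₂ refl , ne) = stop (inj₂ refl , ne)
            to-w (inj₁ Tx , ne) = let e , π , ew = toward-w Td Tx ne in
              snoc (mapP (λ (Ty , ne′) → inj₁ Ty , ne′) π) ew (inj₂ refl , ≢-sym (T≢w Td))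

          Y : V → V → V → Set
          Y a b = Path (Adj G) (λ y → W- t y × y ≢ a) b

          -- All vertices of `T` see `x₁` and `x₂`. The branch sets are `t`, `a`, `Y a b`, `x₁`, and
          -- the component of `x₂` off `T`, `w` and `x₁`. `Y a b` reaches `a` because `W- t` is
          -- connected, and reaches the last two through `y`.
          large : ∀ {a b y} → T a → Adj G t a → W- t b → b ≢ a → Adj G t b → T y → Y a b y → ⊥
          large {a} {b} {y} Ta ta Wb b≢a tb Ty Yy = free (mkK5 adj-symm (_≡ t) (_≡ a) (Y a b) (_≡ x₁) Z
            (single-conn t) (single-conn a) (comp-conn adj-symm) (single-conn x₁) (comp-conn adj-symm)
            ((λ { refl e → adj-irr (subst (Adj G t) (sym e) ta) }) , t , a , refl , refl , ta)
            ((λ { refl p → proj₂ (proj₁ (target p)) refl }) , t , b , refl , stop (Wb , b≢a) , tb)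
            ((λ { refl refl → ¬Cx₁ (T⊆C Tt) }) , t , x₁ , refl , refl , tx₁)
            ((λ { refl p → proj₂ (proj₁ (target p)) Tt }) , t , x₂ , refl , Zx₂ , tx₂)
            ((λ { refl p → proj₂ (target p) refl }) , a-Y)
            ((λ { refl refl → ¬Cx₁ (T⊆C Ta) }) , a , x₁ , refl , refl , t→ Ta ¬Cx₁ tx₁)
            ((λ { refl p → proj₂ (proj₁ (target p)) Ta }) , a , x₂ , refl , Zx₂ , t→ Ta ¬Cx₂ tx₂)
            ((λ { p refl → ¬Cx₁ (W⊆C (proj₁ (proj₁ (target p)))) }) , y , x₁ , Yy , refl , t→ Ty ¬Cx₁ tx₁)
            ((λ p q → [ proj₂ (proj₁ (target q)) , proj₁ (proj₁ (proj₁ (target q))) ]′ (proj₁ (proj₁ (target p))))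
              , y , x₂ , Yy , Zx₂ , t→ Ty ¬Cx₂ tx₂)
            ((λ { refl p → proj₂ (target p) refl }) , x₁-Z))
            where
            W⊆C : ∀ {x} → T x ⊎ x ≡ w → C x
            W⊆C (inj₁ Tx) = T⊆C Tx
            W⊆C (inj₂ refl) = Cw
            Z : V → Set
            Z = Path (Adj G) (λ x → Far w x × x ≢ x₁) x₂
            Zx₂ : Z x₂
            Zx₂ = stop (source x₂x₁ , x₂≢x₁)
            a-Y : Touch (Adj G) (_≡ a) (Y a b)
            a-Y with cross (_≟ a) (W-conn Tt Wb (inj₁ Ta , λ { refl → adj-irr ta })) b≢a refl
            ... | c , _ , π , _ , refl , ca = a , c , refl , π , adj-symm ca
            x₁-Z : Touch (Adj G) (_≡ x₁) Z
            x₁-Z with cross (_≟ x₁) x₂x₁ x₂≢x₁ refl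
            ... | c , _ , π , _ , refl , ca = x₁ , c , refl , π , adj-symm ca

          inner : ∀ {d x} → T d → C x → Adj G d x → T x ⊎ x ≡ w
          inner {d} {x} Td Cx dx with x ≟ w
          ... | yes e = inj₂ e
          ... | no ne = inj₁ (snoc Td dx (Cx , ne))

          -- `t` has two neighbours in `C`, each in `T` or equal to `w`. Two in `T` give a K₅ model;
          -- with only `a` in `T`, `w` is the other one, and a third vertex of `T` gives a model
          -- again. What remains is `T` consisting of `t` and `a`.
          impossible : ⊥
          impossible = two-inner (T⊆C Tt) λ { (y₁ , y₂ , C₁ , C₂ , ty₁ , ty₂ , ne) →
            pick ty₁ ty₂ ne (inner Tt C₁ ty₁) (inner Tt C₂ ty₂) }
            where
            -- Both `t` and `a` are adjacent to `w`, and they have the same neighbours outside `C`,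
            -- so they are adjacent twins.
            small : ∀ {a} → T a → Adj G t a → Adj G t w → (∀ {x} → T x → x ≡ t ⊎ x ≡ a) → ⊥
            small {a} Ta ta tw only = two-inner (T⊆C Ta) λ { (y₁ , y₂ , C₁ , C₂ , ay₁ , ay₂ , ne) →
              twins (aw ay₁ ay₂ ne (inner Ta C₁ ay₁) (inner Ta C₂ ay₂)) }
              where
              aw : ∀ {y₁ y₂} → Adj G a y₁ → Adj G a y₂ → y₁ ≢ y₂ → T y₁ ⊎ y₁ ≡ w → T y₂ ⊎ y₂ ≡ w → Adj G a w
              aw ay₁ ay₂ ne (inj₂ refl) _ = ay₁
              aw ay₁ ay₂ ne _ (inj₂ refl) = ay₂
              aw ay₁ ay₂ ne (inj₁ T₁) (inj₁ T₂) with only T₁ | only T₂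
              ... | inj₂ refl | _ = ⊥-elim (adj-irr ay₁)
              ... | inj₁ _ | inj₂ refl = ⊥-elim (adj-irr ay₂)
              ... | inj₁ refl | inj₁ refl = ⊥-elim (ne refl)
              share : ∀ {d e} → T d → T e → Adj G e w → (∀ {x} → ¬ C x → Adj G d x → Adj G e x) →
                ∀ {x} → x ≢ t → x ≢ a → Adj G d x → Adj G e x
              share Td Te ew out {x} nt na dx with C? x
              ... | no ¬Cx = out ¬Cx dx
              ... | yes Cx with inner Td Cx dx
              ... | inj₂ refl = ew
              ... | inj₁ Tx = ⊥-elim ([ nt , na ]′ (only Tx))
              4≤deg-t : 4 ≤ deg G t
              4≤deg-t = deg-≥ {xs = a ∷ w ∷ x₁ ∷ x₂ ∷ []}
                ((T≢w Ta ∷ (λ { refl → ¬Cx₁ (T⊆C Ta) }) ∷ (λ { refl → ¬Cx₂ (T⊆C Ta) }) ∷ [])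
                  ∷ ((λ { refl → ¬Cx₁ Cw }) ∷ (λ { refl → ¬Cx₂ Cw }) ∷ []) ∷ (≢-sym x₂≢x₁ ∷ []) ∷ [] ∷ [])
                λ { (here refl) → ta ; (there (here refl)) → tw ; (there (there (here refl))) → tx₁
                  ; (there (there (there (here refl)))) → tx₂ }
              4≤deg : ∀ {x} → x ≢ t → x ≢ a → Adj G t x → 4 ≤ deg G x
              4≤deg {x} nt na tx with C? x
              ... | no ¬Cx = ℕ.≤-trans (ℕ.≤-trans (ℕ.m≤m+n 4 3) 7≤k) (ℕ.≮⇒≥ (¬Cx ∘ closed (T⊆C Tt) tx))
              ... | yes Cx with inner Tt Cx tx
              ... | inj₁ Tx = ⊥-elim ([ nt , na ]′ (only Tx))
              -- By `lists-grow` the list of `t` is contained in that of `w`, so the degree of `w`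
              -- is at least that of `t`.
              ... | inj₂ refl = ℕ.≤-trans 4≤deg-t (ℕ.≤-trans (ℕ.≤-reflexive (sym (|L| (T⊆C Tt))))
                (ℕ.≤-trans (⊆-length ℕ._≟_ (uniq t) (lists-grow (T⊆C Tt) Cw tw (noncut Tt)))
                  (ℕ.≤-reflexive (|L| Cw))))
              twins : Adj G a w → ⊥
              twins aw = true-twins ta (share Tt Ta aw (t→ Ta)) (share Ta Tt tw (→t Ta)) 4≤deg
                {w} {x₁} (λ { refl → ¬Cx₁ Cw }) (λ { refl → ¬Cx₁ (T⊆C Tt) }) (λ { refl → ¬Cx₁ (T⊆C Ta) })
                (≢-sym (T≢w Tt)) (≢-sym (T≢w Ta)) tw

            one-branch : ∀ {a} → T a → Adj G t a → Adj G t w → ⊥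
            one-branch {a} Ta ta tw = by-cases (∃[ b ] (T b × Adj G t b × b ≢ a))
              (λ (b , Tb , tb , b≢a) → let Wb = inj₁ Tb , λ { refl → adj-irr tb } in
                large Ta ta Wb b≢a tb Tb (stop (Wb , b≢a)))
              (λ no-b → by-cases (∃[ y ] (T y × y ≢ t × y ≢ a))
                (λ (y , Ty , y≢t , y≢a) → third no-b Ty y≢t y≢a)
                (λ no-y → small Ta ta tw (only no-y)))
              where
              -- Inside `T`, `y` leads off `a` to a neighbour `e` of `w`. It is not `t`, whose only
              -- neighbour in `T` is `a`; so `Y a w` contains a vertex of `T`.
              third : ¬ (∃[ b ] (T b × Adj G t b × b ≢ a)) → ∀ {y} → T y → y ≢ t → y ≢ a → ⊥
              third no-b {y} Ty y≢t y≢a with toward-w Ta Ty y≢a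
              ... | e , π , ew = large Ta ta Ww (≢-sym (T≢w Ta)) tw (proj₁ (target π))
                (go (Ww , ≢-sym (T≢w Ta)) (adj-symm ew) (stop ((inj₁ (proj₁ (target π)) , e≢t) , proj₂ (target π))))
                where
                Ww : W- t w
                Ww = inj₂ refl , ≢-sym (T≢w Tt)
                e≢t : e ≢ t
                e≢t e≡t with cross (_≟ t) π y≢t e≡t
                ... | b , _ , ρ , _ , refl , bt =
                  no-b (b , proj₁ (proj₁ (target ρ)) , adj-symm bt , proj₂ (proj₁ (target ρ)))
              only : ¬ (∃[ y ] (T y × y ≢ t × y ≢ a)) → ∀ {x} → T x → x ≡ t ⊎ x ≡ a
              only no-y {x} Tx with x ≟ t | x ≟ a
              ... | yes e | _ = inj₁ e
              ... | no _ | yes e = inj₂ e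
              ... | no nt | no na = ⊥-elim (no-y (x , Tx , nt , na))

            pick : ∀ {y₁ y₂} → Adj G t y₁ → Adj G t y₂ → y₁ ≢ y₂ → T y₁ ⊎ y₁ ≡ w → T y₂ ⊎ y₂ ≡ w → ⊥
            pick ty₁ ty₂ ne (inj₂ refl) (inj₂ refl) = ne refl
            pick ty₁ ty₂ ne (inj₁ T₁) (inj₂ refl) = one-branch T₁ ty₁ ty₂
            pick ty₁ ty₂ ne (inj₂ refl) (inj₁ T₂) = one-branch T₂ ty₂ ty₁
            pick ty₁ ty₂ ne (inj₁ T₁) (inj₁ T₂) = let W₂ = inj₁ T₂ , λ { refl → adj-irr ty₂ } in
              large T₁ ty₁ W₂ (≢-sym ne) ty₂ T₂ (stop (W₂ , ≢-sym ne))

        contradiction : ⊥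
        -- First only `w` is deleted, then `w` and `x₁`, which gives a second vertex `x₂`. The two
        -- paths from `s′` join `x₂` to `x₁` off `T` and `w`.
        contradiction with outside w (λ { refl → ¬Cs′ Cw }) (λ p → T≢w p refl)
        ... | x₁ , ¬Cx₁ , tx₁ , π₁ with outside x₁ (λ { refl → s′-far (T⊆C Tt) tx₁ }) (¬Cx₁ ∘ T⊆C)
        ... | x₂ , ¬Cx₂ , tx₂ , π₂ = Ends.impossible ¬Cx₁ ¬Cx₂ tx₁ tx₂ (proj₂ (proj₁ (target π₂)))
          (reverse adj-symm (mapP (λ ((nw , _) , ¬T) → (nw , nw) , ¬T) π₂) ++P π₁)

    plan : ¬ ¬ Plan L uniq C
    -- A neighbour `y` of `s` in `C` is the second vertex that `end-part` asks for.
    plan no-plan = two-inner no-plan Cs λ { (y , _ , Cy , _ , sy , _) →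
      end-part adj-symm cC Cs Cy (λ { refl → adj-irr sy }) λ (w , t , Cw , Mt , _ , noncut) →
      decide λ T? → EndPart.contradiction no-plan Cw Mt noncut T? }

-- Decidability of list colouring.

colouring? : (L : Fin N → List ℕ) (P : (Fin N → ℕ) → Set) → (∀ φ → Dec (P φ)) →
  (∀ {φ ψ} → (∀ x → φ x ≡ ψ x) → P φ → P ψ) → Dec (Σ (Fin N → ℕ) λ φ → (∀ x → φ x ∈ L x) × P φ)
colouring? {zero} L P P? ext = map′ (λ p → empty , (λ ()) , p) (λ (φ , _ , p) → ext (λ ()) p) (P? empty)
  where
  empty : Fin 0 → ℕ
  empty ()
-- The colours of the first vertex are tried one by one. As a colouring is rebuilt from its first
-- value and the rest, `ext` stands in for function extensionality.
colouring? {suc N} L P P? ext = map′ to from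
  (any? (λ c → colouring? (L ∘ suc) (P ∘ cons c) (P? ∘ cons c) (λ e → ext (cons-cong e))) (L zero))
  where
  cons : ℕ → (Fin N → ℕ) → Fin (suc N) → ℕ
  cons c φ zero = c
  cons c φ (suc x) = φ x
  cons-cong : ∀ {c φ ψ} → (∀ x → φ x ≡ ψ x) → ∀ x → cons c φ x ≡ cons c ψ x
  cons-cong e zero = refl
  cons-cong e (suc x) = e x
  Rest : ℕ → Set
  Rest c = Σ (Fin N → ℕ) λ φ → (∀ x → φ x ∈ L (suc x)) × P (cons c φ)
  to : Any Rest (L zero) → Σ (Fin (suc N) → ℕ) λ φ → (∀ x → φ x ∈ L x) × P φ
  to r with find r
  ... | c , c∈ , φ , φ∈ , p = cons c φ , (λ { zero → c∈ ; (suc x) → φ∈ x }) , p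
  from : (Σ (Fin (suc N) → ℕ) λ φ → (∀ x → φ x ∈ L x) × P φ) → Any Rest (L zero)
  from (φ , φ∈ , p) = lose (φ∈ zero) (φ ∘ suc , φ∈ ∘ suc , ext (λ { zero → refl ; (suc x) → refl }) p)

-- Contracting all components of small degree and colouring the rest.

open FiveChoosability using (solve₀)

module Assembly (k : ℕ) (7≤k : 7 ≤ k) (G : Graph) (free : K5Free (Adj G)) (three : KConnected 3 G)
  (ds : DSGe3 G k) (L : Vertex G → List ℕ) (uniq : ∀ x → Unique (L x)) (len : ∀ x → length (L x) ≡ deg G x ⊓ k) where

  open OnGraph G
  open ThreeConnected G free three
  open Lists L uniq

  Low : V → Set
  Low = InS G k

  low? : ∀ x → Dec (Low x)
  low? x = deg G x ℕ.<? k

  R : V → V → Set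
  R = Path (Adj G) Low

  R-sym : ∀ {x y} → R x y → R y x
  R-sym = reverse adj-symm

  low-irr : ∀ {x} (p q : Low x) → p ≡ q
  low-irr = ℕ.<-irrelevant

  u₀ v₀ : V
  u₀ = proj₁ (proj₁ ds)
  v₀ = proj₁ (proj₂ (proj₁ ds))
  low-u₀ : Low u₀
  low-u₀ = proj₁ (proj₂ (proj₂ (proj₁ ds)))
  low-v₀ : Low v₀
  low-v₀ = proj₁ (proj₂ (proj₂ (proj₂ (proj₁ ds))))
  ¬u₀v₀ : ¬ R u₀ v₀
  ¬u₀v₀ = proj₂ (proj₂ (proj₂ (proj₂ (proj₁ ds)))) ∘ toWalk

  module Classes (R? : ∀ x y → Dec (R x y)) where

    headOr : V → List V → V
    headOr x [] = x
    headOr _ (y ∷ _) = y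

    headOr-irrelevant : ∀ {z x y xs} → z ∈ xs → headOr x xs ≡ headOr y xs
    headOr-irrelevant {xs = _ ∷ _} _ = refl

    headOr-∈ : ∀ {z x xs} → z ∈ xs → headOr x xs ∈ xs
    headOr-∈ {xs = _ ∷ _} _ = here refl

    class : V → List V
    class s = filter (R? s) (allFin (n G))

    -- The first vertex of the component in a fixed order, so that all vertices of a component have
    -- equal representatives.
    rep : V → V
    rep s = headOr s (class s)

    self∈ : ∀ {s} → Low s → s ∈ class s
    self∈ l = ∈-filter⁺ (R? _) (∈-allFin _) (stop l)

    R-rep : ∀ {s} → Low s → R s (rep s)
    R-rep {s} l = proj₂ (∈-filter⁻ (R? s) {xs = allFin (n G)} (headOr-∈ (self∈ l)))

    rep-cong : ∀ {s t} → R s t → rep s ≡ rep t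
    rep-cong {s} {t} p = trans (cong (headOr s) (filter-≐ (R? s) (R? t) ((R-sym p ++P_) , (p ++P_)) (allFin (n G))))
      (headOr-irrelevant (self∈ (target p)))

    another-class : ∀ r → ∃[ s ] (¬ R r s × Low s)
    another-class r with R? r u₀
    ... | yes p = v₀ , (λ q → ¬u₀v₀ (R-sym p ++P q)) , low-v₀
    ... | no ¬p = u₀ , ¬p , low-u₀

    -- Through `y` the two vertices are at distance at most two, less than the distance between
    -- components.
    near-unique : ∀ {s c y} → Low s → Low c → Adj G y s → Adj G y c → R s c
    near-unique {s} {c} {y} ls lc ys yc with R? s c
    ... | yes p = p
    ... | no ¬p = ⊥-elim (proj₂ ds s c ls lc (λ (_ , w) → ¬p (toPath w)) 2 (s≤s (s≤s (s≤s z≤n)))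
      (step tt (adj-symm ys) (step tt yc (here tt))))

    plan-for : ∀ r → ¬ ¬ (Low r → Plan L uniq (R r))
    plan-for r no-plan with low? r
    ... | no h = no-plan (λ l → ⊥-elim (h l))
    ... | yes l = let s , ¬rs , ls = another-class r in
      Component.plan k 7≤k L uniq len (R r) (R? r) (comp-conn adj-symm) target
        (λ p a l′ → snoc p a l′) (stop l) ¬rs ls (λ P → no-plan (λ _ → P))

    module Plans (plans : ∀ r → Low r → Plan L uniq (R r)) where

      planOf : ∀ s → Low s → Plan L uniq (R (rep s))
      planOf s l = plans (rep s) (target (R-rep l))

      same : ∀ {X : Set} (f : ∀ r → Low r → X) {r r′} → r ≡ r′ → ∀ l l′ → f r l ≡ f r′ l′
      same f refl l l′ = cong (f _) (low-irr l l′)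

      -- The contraction map; several components may be sent to the same vertex.
      centre : V → V
      centre s with low? s
      ... | yes l = Plan.x₀ (planOf s l)
      ... | no _ = s

      centre-high : ∀ {x} → ¬ Low x → centre x ≡ x
      centre-high {x} h with low? x
      ... | yes l = ⊥-elim (h l)
      ... | no _ = refl

      centre-low : ∀ {s} (l : Low s) → centre s ≡ Plan.x₀ (planOf s l)
      centre-low {s} l with low? s
      ... | yes l′ = cong (λ p → Plan.x₀ (planOf s p)) (low-irr l′ l)
      ... | no h = ⊥-elim (h l)

      centre-cong : ∀ {s t} → R s t → centre s ≡ centre t
      centre-cong p = trans (centre-low (source p)) (trans
        (same (λ r l → Plan.x₀ (plans r l)) (rep-cong p) _ _) (sym (centre-low (target p))))

      x₀-high : ∀ {s} (l : Low s) → ¬ Low (Plan.x₀ (planOf s l))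
      x₀-high l h = let c , p , a = Plan.x₀-touches (planOf _ l) in Plan.x₀∉ (planOf _ l) (snoc p a h)

      InClass : V → V → Set
      InClass w x = centre w ≡ x

      toCentre : ∀ {w x} → InClass w x → Path (Adj G) (λ w → InClass w x) w x
      toCentre {w} {x} refl with low? w in eq
      ... | no h = stop (centre-high h)
      ... | yes l with Plan.x₀-touches (planOf w l)
      ... | c , p , a = snoc (mapP (λ q → trans (sym (centre-cong q)) (centre-low l)) (reach (R-rep l ++P p))) a
                          (centre-high (x₀-high l))

      A : V → V → Set
      A = Quot (Adj G) InClass

      A-free : K5Free A
      A-free = Quot-free (λ e e′ → trans (sym e) e′)
        (λ _ e e′ → toCentre e ++P reverse adj-symm (toCentre e′)) free

      near? : ∀ x → Dec (∃[ s ] (Low s × Adj G x s))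
      near? x = map′ (λ r → let s , _ , h = find r in s , h) (λ (s , h) → lose (∈-allFin s) h)
        (any? (λ s → low? s ×-dec Adj? x s) (allFin (n G)))

      -- By `near-unique` the neighbours of small degree lie in one component, so the choice of `s`
      -- does not matter and two colours at most are withheld.
      L′ : V → List ℕ
      L′ x with near? x
      ... | yes (s , l , _) = remC (Plan.α (planOf s l)) (remC (Plan.β (planOf s l)) (L x))
      ... | no _ = L x

      L′-unique : ∀ x → Unique (L′ x)
      L′-unique x with near? x
      ... | yes (s , l , _) = remC-unique _ (remC-unique _ (uniq x))
      ... | no _ = uniq x

      L′-⊆ : ∀ {x c} → c ∈ L′ x → c ∈ L x
      L′-⊆ {x} c∈ with near? x
      ... | yes (s , l , _) = prune-⊆ (yes tt) _ _ c∈
      ... | no _ = c∈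

      L′-length : ∀ {x} → ¬ Low x → 5 ≤ length (L′ x)
      L′-length {x} h with near? x
      ... | yes (s , l , _) = ℕ.+-cancelˡ-≤ 2 _ _ (ℕ.≤-trans |L|≥7 (prune-length (yes tt) _ _ (uniq x)))
        where
        |L|≥7 : 7 ≤ length (L x)
        |L|≥7 = ℕ.≤-trans 7≤k (ℕ.≤-reflexive (sym (trans (len x) (ℕ.m≥n⇒m⊓n≡n (ℕ.≮⇒≥ h)))))
      ... | no _ = ℕ.≤-trans (ℕ.m≤m+n 5 2) (ℕ.≤-trans 7≤k
        (ℕ.≤-reflexive (sym (trans (len x) (ℕ.m≥n⇒m⊓n≡n (ℕ.≮⇒≥ h))))))

      L′-avoids : ∀ {c y d} (l : Low c) → Adj G c y → d ∈ L′ y →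
        d ≢ Plan.α (planOf c l) × d ≢ Plan.β (planOf c l)
      L′-avoids {c} {y} l cy d∈ with near? y
      ... | no none = ⊥-elim (none (c , l , adj-symm cy))
      ... | yes (s , ls , ys) with near-unique ls l ys (adj-symm cy) | prune-avoid (yes tt) (Plan.α (planOf s ls)) (Plan.β (planOf s ls)) {L y} tt d∈
      ... | p | ≢α , ≢β = (λ e → ≢α (trans e (sym (same (λ r l → Plan.α (plans r l)) (rep-cong p) _ _))))
                        , (λ e → ≢β (trans e (sym (same (λ r l → Plan.β (plans r l)) (rep-cong p) _ _))))

      highs : List V
      highs = filter (¬? ∘ low?) (allFin (n G))

      highs⁺ : ∀ {x} → ¬ Low x → x ∈ highs
      highs⁺ = ∈-filter⁺ (¬? ∘ low?) (∈-allFin _)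

      highs⁻ : ∀ {x} → x ∈ highs → ¬ Low x
      highs⁻ = proj₂ ∘ ∈-filter⁻ (¬? ∘ low?) {xs = allFin (n G)}

      -- No branch set is centred at u₀, so the root is an isolated vertex.
      S : Rooted (n G)
      S = record { A = A ; symA = Quot-sym adj-symm ; irrA = Quot-irr {F = InClass} ; free = A-free ; z = u₀
                 ; l = highs ; z∉l = λ u∈ → highs⁻ u∈ low-u₀ ; L = L′ ; uniq = L′-unique }

      S-sizes : Rooted.Sizes S (λ _ → ⊥)
      S-sizes x∈ _ = let five = L′-length (highs⁻ x∈) in ℕ.≤-trans (ℕ.m≤m+n 3 2) five , λ _ → five

      module Extend (φ : V → ℕ) (φ∈ : ∀ {x} → x ∈ highs → φ x ∈ L′ x)
        (proper : ∀ {x y} → x ∈ highs → y ∈ highs → A x y → φ x ≢ φ y) where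

        Ext : V → Set
        Ext r = ∃[ ψ ] ((∀ {y} → ¬ R (rep r) y → ψ y ≡ φ y) × (∀ {w} → R (rep r) w → Fits ψ w))

        extend : ∀ r → ¬ ¬ (Low r → Ext r)
        extend r none with low? r
        ... | no h = none (λ l → ⊥-elim (h l))
        ... | yes l = Plan.extend (planOf r l) φ forb distinct (λ e → none (λ _ → e))
          where
          high : ∀ {c y} → R (rep r) c → Adj G c y → ¬ R (rep r) y → ¬ Low y
          high p cy ¬p ly = ¬p (snoc p cy ly)
          forb : ∀ {c y} → R (rep r) c → Adj G c y → ¬ R (rep r) y →
            φ y ≢ Plan.α (planOf r l) × φ y ≢ Plan.β (planOf r l)
          forb p cy ¬p with L′-avoids (target p) cy (φ∈ (highs⁺ (high p cy ¬p)))
          ... | ≢α , ≢β = (λ e → ≢α (trans e (same (λ r l → Plan.α (plans r l)) (rep-cong (R-rep l ++P p)) _ _)))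
                        , (λ e → ≢β (trans e (same (λ r l → Plan.β (plans r l)) (rep-cong (R-rep l ++P p)) _ _)))
          -- The neighbour `c` of `y` is contracted to `x₀`, so `y` and `x₀` are adjacent in `A`.
          distinct : ∀ {c y} → R (rep r) c → Adj G c y → ¬ R (rep r) y → y ≢ Plan.x₀ (planOf r l) →
            φ y ≢ φ (Plan.x₀ (planOf r l))
          distinct {c} {y} p cy ¬p ne = proper (highs⁺ (high p cy ¬p)) (highs⁺ (x₀-high l))
            (ne , y , c , centre-high (high p cy ¬p)
            , trans (sym (centre-cong (R-rep l ++P p))) (centre-low l) , adj-symm cy)

        module _ (ext : ∀ r → Low r → Ext r) where

          ψ : ∀ r → Low r → V → ℕ
          ψ r l = proj₁ (ext r l)

          final : V → ℕ
          final x with low? x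
          ... | yes l = ψ (rep x) (target (R-rep l)) x
          ... | no _ = φ x

          -- Extensions are taken at `rep x`, and `Ext` applies `rep` once more.
          here′ : ∀ {x} → Low x → R (rep (rep x)) x
          here′ l = R-sym (R-rep l ++P R-rep (target (R-rep l)))

          result : LColorable G L
          result = final , in-list , distinct
            where
            in-list : ∀ x → final x ∈ L x
            in-list x with low? x
            ... | yes l = proj₁ (proj₂ (proj₂ (ext _ _)) (here′ l))
            ... | no h = L′-⊆ (φ∈ (highs⁺ h))
            mixed : ∀ {x y} (l : Low x) → ¬ Low y → Adj G x y → ψ (rep x) (target (R-rep l)) x ≢ φ y
            mixed l h a e = proj₂ (proj₂ (proj₂ (ext _ _)) (here′ l)) a
              (trans e (sym (proj₁ (proj₂ (ext _ (target (R-rep l)))) (h ∘ target))))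
            distinct : ∀ x y → Adj G x y → final x ≢ final y
            distinct x y a with low? x | low? y
            ... | yes l | no h = mixed l h a
            ... | no h | yes l = ≢-sym (mixed l h (adj-symm a))
            ... | no hx | no hy = proper (highs⁺ hx) (highs⁺ hy)
              ((λ { refl → adj-irr a }) , x , y , centre-high hx , centre-high hy , a)
            -- Adjacent vertices of small degree share a component, so both colours come from the
            -- same extension.
            ... | yes l | yes l′ = λ e → proj₂ (proj₂ (proj₂ (ext _ _)) (here′ l)) a
              (trans e (same (λ r l → ψ r l y) (sym (rep-cong (go l a (stop l′)))) _ _))

  colourable : ¬ ¬ LColorable G L
  colourable none = decide₂ λ R? → let open Classes R? in
    ¬¬-Π plan-for λ plans → let open Plans plans in
    solve₀ _ S ℕ.≤-refl S-sizes λ (φ , φ∈ , proper) → let open Extend φ φ∈ proper in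
    ¬¬-Π extend λ ext → none (result ext)

theorem8 : (k : ℕ) → 7 ≤ k → (G : Graph) →
    ¬ HasMinor G (K 5) → NonComplete G → KConnected 3 G →
    DSGe3 G k → FListColorable G (λ v → deg G v ⊓ k)
theorem8 k 7≤k G no-minor _ three ds L uniq len = decidable-stable
  (colouring? L _ (λ φ → all? λ u → all? λ v → OnGraph.Adj? G u v →-dec ¬? (φ u ℕ.≟ φ v))
    (λ e p u v a eq → p u v a (trans (e u) (trans eq (sym (e v))))))
  (Assembly.colourable k 7≤k G (OnGraph.minor-free G no-minor) three ds L uniq len)
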